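{- Let $G$ be a finite simple chordal outerplanar graph with maximum degree $\Delta$. Then $\omega(G^2) = \chi(G^2) = \Delta + 2$ if $\Delta = 4$ and $F_4$ is a subgraph of $G$, and $\omega(G^2) = \chi(G^2) = \Delta + 1$ in all other cases.
   Context: $G^2$ is the graph on $V(G)$ in which two distinct vertices are adjacent iff their distance in $G$ is 1 or 2; $\omega$ is the clique number and $\chi$ the chromatic number. $F_4$ is the 6-vertex graph obtained from a triangle $K_3$ by adding, for each of its three edges, a new vertex adjacent to both endpoints of that edge. -}

module Defs where

open import Data.Nat using (ℕ; zero; suc; _+_; _∸_; _<_; _≤_; _⊔_)
open import Data.Fin using (Fin; toℕ; #_)
open import Data.Fin.Properties using () renaming (_≟_ to _≟F_)
open import Data.Bool using (Bool; true; false; _∧_; _∨_; not)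
open import Data.List using (List; length; filter; map; foldr; allFin)
open import Data.Bool.ListAction using (any)
open import Data.Product using (Σ; _×_; _,_; ∃)
open import Data.Sum using (_⊎_)
open import Relation.Nullary using (¬_; does)
open import Relation.Binary.PropositionalEquality using (_≡_; _≢_)
open import Function.Definitions using (Injective)

record Graph (n : ℕ) : Set where
  field
    adj   : Fin n → Fin n → Bool
    sym   : ∀ u v → adj u v ≡ adj v u
    irref : ∀ v → adj v v ≡ false
open Graph public

Edge : ∀ {n} → Graph n → Fin n → Fin n → Set
Edge G u v = adj G u v ≡ true

degree : ∀ {n} → Graph n → Fin n → ℕ
degree {n} G v = length (filter (λ w → adj G v w ≟ᵇ true) (allFin n))
  where
    open import Data.Bool.Properties using () renaming (_≟_ to _≟ᵇ_)

maxDegree : ∀ {n} → Graph n → ℕ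
maxDegree {n} G = foldr _⊔_ 0 (map (degree G) (allFin n))

square-adj : ∀ {n} → Graph n → Fin n → Fin n → Bool
square-adj {n} G u v =
  not (does (u ≟F v)) ∧ (adj G u v ∨ any (λ w → adj G u w ∧ adj G w v) (allFin n))


IsClique : ∀ {n} → (Fin n → Fin n → Bool) → (k : ℕ) → (Fin k → Fin n) → Set
IsClique H k f = Injective _≡_ _≡_ f × (∀ i j → i ≢ j → H (f i) (f j) ≡ true)

CliqueNumber : ∀ {n} → (Fin n → Fin n → Bool) → ℕ → Set
CliqueNumber {n} H k =
  (Σ (Fin k → Fin n) (IsClique H k)) ×
  (∀ m (f : Fin m → Fin n) → IsClique H m f → m ≤ k)

IsProperColouring : ∀ {n} → (Fin n → Fin n → Bool) → (k : ℕ) → (Fin n → Fin k) → Set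
IsProperColouring H k c = ∀ u v → H u v ≡ true → c u ≢ c v

ChromaticNumber : ∀ {n} → (Fin n → Fin n → Bool) → ℕ → Set
ChromaticNumber {n} H k =
  (Σ (Fin n → Fin k) (IsProperColouring H k)) ×
  (∀ m (c : Fin n → Fin m) → IsProperColouring H m c → k ≤ m)

CycSucc : (k : ℕ) → Fin k → Fin k → Set
CycSucc k i j = (suc (toℕ i) ≡ toℕ j) ⊎ ((toℕ i ≡ k ∸ 1) × (toℕ j ≡ 0))

IsCycle : ∀ {n} → Graph n → (k : ℕ) → (Fin k → Fin n) → Set
IsCycle G k c = Injective _≡_ _≡_ c × (∀ i j → CycSucc k i j → Edge G (c i) (c j))

HasChord : ∀ {n} → Graph n → (k : ℕ) → (Fin k → Fin n) → Set
HasChord G k c = Σ (Fin k) λ i → Σ (Fin k) λ j →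
  ¬ CycSucc k i j × ¬ CycSucc k j i × Edge G (c i) (c j)

Chordal : ∀ {n} → Graph n → Set
Chordal {n} G = ∀ k (c : Fin k → Fin n) → 4 ≤ k → IsCycle G k c → HasChord G k c

-- Outerplanar: the vertices can be placed in convex position (on a circle,
-- in the order given by an injective position map p) so that edges drawn as
-- straight chords do not cross.
Outerplanar : ∀ {n} → Graph n → Set
Outerplanar {n} G = Σ (Fin n → ℕ) λ p → Injective _≡_ _≡_ p ×
  (∀ a b c d → Edge G a b → Edge G c d →
     ¬ (p a < p c × p c < p b × p b < p d))

-- F₄: triangle 0,1,2; vertex 3 on edge 01, 4 on edge 12, 5 on edge 02
data F4Edge : Fin 6 → Fin 6 → Set where
  e01 : F4Edge (# 0) (# 1)
  e12 : F4Edge (# 1) (# 2)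
  e02 : F4Edge (# 0) (# 2)
  e30 : F4Edge (# 3) (# 0)
  e31 : F4Edge (# 3) (# 1)
  e41 : F4Edge (# 4) (# 1)
  e42 : F4Edge (# 4) (# 2)
  e50 : F4Edge (# 5) (# 0)
  e52 : F4Edge (# 5) (# 2)

ContainsF4 : ∀ {n} → Graph n → Set
ContainsF4 {n} G = Σ (Fin 6 → Fin n) λ f → Injective _≡_ _≡_ f ×
  (∀ x y → F4Edge x y → Edge G (f x) (f y))

{-# OPTIONS --safe #-}
-- Cliques of G² come from a closed neighbourhood, or from F₄, any two of whose vertices are within
-- distance 2.  For the upper bound, G² is coloured with k colours whenever k > Δ and either k ≥ 6 or G
-- contains no F₄.  Draw the vertices on a line.  Beyond an edge ab (a < b) chordality leaves two options:
-- there is a common neighbour t strictly between a and b, or the interval can be cut so that ab is the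
-- only edge across.  Proceed recursively into intervals, reserving for a and b lists P and Q of colours,
-- exactly as many as they have neighbours inside.  A common neighbour t takes a colour τ ∈ P ∩ Q; the
-- lists L and M of t for the sides at and tb must be disjoint, avoid the colours of a, b and t, and
-- meet P \ τ and Q \ τ respectively.  Since deg t < k there is room for them, and the choice can be
-- repeated inside as long as P \ τ and Q \ τ are not the same singleton (and, for k = 6, a pair and a
-- nonempty list of remaining colours overlap); L and M can be chosen to preserve this when k ≥ 6, and
-- for k = 5 a violation of it exhibits an F₄.
module Submission where

open import Defs renaming (sym to adj-sym)
open import Data.Nat using (ℕ; zero; suc; _+_; _*_; _∸_; _⊔_; _≤_; _<_; z≤n; s≤s; _≤?_; _<?_; _≟_)
open import Data.Nat.Properties
open import Data.Nat.Solver using (module +-*-Solver)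
open +-*-Solver using (_:+_; _:=_) renaming (solve to solve-+)
open import Data.Bool using (Bool; true; false; if_then_else_; _∧_; _∨_)
open import Data.Bool.ListAction using (any)
open import Data.Bool.Properties using () renaming (_≟_ to _≟ᵇ_)
open import Data.Fin using (Fin; toℕ; zero; suc; #_)
open import Data.Fin.Properties using (toℕ<n; toℕ-injective; injective⇒≤) renaming (_≟_ to _≟F_; any? to anyF?)
open import Data.List using (List; []; _∷_; [_]; length; _++_; allFin; lookup; filter; map; foldr; tabulate)
open import Data.List.Properties using (length-++; length-map; length-tabulate; ∷-injectiveˡ)
open import Data.List.Membership.Propositional using (_∈_; _∉_; find; lose)
open import Data.List.Membership.Propositional.Properties using (∈-∃++; ∈-++⁺ˡ; ∈-++⁺ʳ; ∈-++⁻; ∈-allFin; ∈-lookup; ∈-filter⁺; ∈-filter⁻; ∈-map⁺)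
open import Data.List.Membership.DecPropositional using (_∈?_)
open import Data.List.Relation.Binary.Subset.Propositional using (_⊆_)
open import Data.List.Relation.Unary.Any using (here; there; any?)
open import Data.List.Relation.Unary.All using ([]; _∷_)
open import Data.List.Relation.Unary.All.Properties using (¬Any⇒All¬; All¬⇒¬Any)
open import Data.List.Relation.Unary.AllPairs using ([]; _∷_)
open import Data.List.Relation.Unary.Unique.Propositional using (Unique)
open import Data.List.Relation.Unary.Unique.Propositional.Properties using (++⁺; allFin⁺; map⁺; filter⁺)
open import Data.List.Relation.Unary.Unique.DecPropositional using (unique?)
open import Data.Product using (Σ; ∃-syntax; _×_; _,_; proj₁; proj₂)
open import Data.Sum using (_⊎_; inj₁; inj₂; [_,_]′)
open import Data.Empty using (⊥; ⊥-elim)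
open import Function using (_∘_; _|>_)
open import Function.Definitions using (Injective)
open import Relation.Binary.Definitions using (tri<; tri≈; tri>)
open import Relation.Binary.PropositionalEquality using (_≡_; _≢_; refl; sym; trans; cong; cong₂; subst)
open import Relation.Nullary using (¬_; Dec; yes; no; does; contradiction)
open import Relation.Nullary.Decidable using (¬?; decidable-stable; _×-dec_; dec-true; from-yes)

-- Lists without repetitions

module _ {A : Set} where

  unique-∷ : ∀ {x : A} {xs} → x ∉ xs → Unique xs → Unique (x ∷ xs)
  unique-∷ x∉xs u = ¬Any⇒All¬ _ x∉xs ∷ u

  head∉tail : ∀ {x : A} {xs} → Unique (x ∷ xs) → x ∉ xs
  head∉tail (x≢ ∷ _) = All¬⇒¬Any x≢

  unique-tail : ∀ {x : A} {xs} → Unique (x ∷ xs) → Unique xs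
  unique-tail (_ ∷ u) = u

  extract : ∀ {x : A} {xs} → x ∈ xs → Unique xs →
    ∃[ ys ] Unique (x ∷ ys) × length xs ≡ suc (length ys) × x ∷ ys ⊆ xs × xs ⊆ x ∷ ys
  extract {x} {y ∷ xs} (here refl) u = xs , u , refl , (λ z → z) , (λ z → z)
  extract {x} {y ∷ xs} (there x∈xs) u
    with ys , u′ , eq , sub , sup ← extract x∈xs (unique-tail u) =
      y ∷ ys , unique-∷ x∉ (unique-∷ y∉ (unique-tail u′)) , cong suc eq , sub′ , sup′
    where
    y∉ : y ∉ ys
    y∉ y∈ = head∉tail u (sub (there y∈))
    x∉ : x ∉ y ∷ ys
    x∉ (here refl) = head∉tail u x∈xs
    x∉ (there p) = head∉tail u′ p
    sub′ : x ∷ y ∷ ys ⊆ y ∷ xs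
    sub′ (here refl) = there x∈xs
    sub′ (there (here refl)) = here refl
    sub′ (there (there p)) = there (sub (there p))
    sup′ : y ∷ xs ⊆ x ∷ y ∷ ys
    sup′ (here refl) = there (here refl)
    sup′ (there p) with sup p
    ... | here eq = here eq
    ... | there q = there (there q)

  ⊆⇒length≤ : ∀ {xs ys : List A} → Unique xs → xs ⊆ ys → length xs ≤ length ys
  ⊆⇒length≤ {[]} _ _ = z≤n
  ⊆⇒length≤ {x ∷ xs} {ys} u sub with ys₁ , ys₂ , refl ← ∈-∃++ (sub (here refl)) =
    ≤-trans (s≤s (⊆⇒length≤ (unique-tail u) sub′)) (≤-reflexive eq)
    where
    sub′ : xs ⊆ ys₁ ++ ys₂
    sub′ {z} z∈ with ∈-++⁻ ys₁ (sub (there z∈))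
    ... | inj₁ p = ∈-++⁺ˡ p
    ... | inj₂ (here refl) = contradiction z∈ (head∉tail u)
    ... | inj₂ (there p) = ∈-++⁺ʳ ys₁ p
    eq : suc (length (ys₁ ++ ys₂)) ≡ length (ys₁ ++ x ∷ ys₂)
    eq = trans (cong suc (length-++ ys₁)) (trans (sym (+-suc _ _)) (sym (length-++ ys₁)))

  infix 4 _#_
  _#_ : List A → List A → Set
  xs # ys = ∀ {c} → c ∈ xs → c ∉ ys

  #-sym : ∀ {xs ys} → xs # ys → ys # xs
  #-sym d p q = d q p

  ++-# : ∀ {xs ys zs} → xs # zs → ys # zs → xs ++ ys # zs
  ++-# {xs} d e p = [ d , e ]′ (∈-++⁻ xs p)

  #-++ : ∀ {xs ys zs} → xs # ys → xs # zs → xs # ys ++ zs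
  #-++ {ys = ys} d e p = [ d p , e p ]′ ∘ ∈-++⁻ ys

  ∷-# : ∀ {x : A} {xs zs} → x ∉ zs → xs # zs → x ∷ xs # zs
  ∷-# d e (here refl) = d
  ∷-# d e (there p) = e p

-- The counting behind `fill`: `p ∸ a` new colours are drawn while `x + (a + b)` are forbidden, and
-- the `a` entries already present cancel.
fill-room : ∀ {a b p q k} x → a ≤ p → b ≤ q → x + (p + q) ≤ k → p ∸ a + (x + (a + b)) ≤ k
fill-room {a} {b} {p} {q} {k} x a≤p b≤q le = begin
  p ∸ a + (x + (a + b))  ≡⟨ solve-+ 4 (λ x a b d → d :+ (x :+ (a :+ b)) := x :+ (d :+ a :+ b)) refl x a b (p ∸ a) ⟩
  x + (p ∸ a + a + b)    ≤⟨ +-monoʳ-≤ x (+-mono-≤ (≤-reflexive (m∸n+n≡m a≤p)) b≤q) ⟩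
  x + (p + q)            ≤⟨ le ⟩
  k                      ∎
  where open ≤-Reasoning

-- Choosing colours

module Palette (k : ℕ) where

  C : Set
  C = Fin k

  unique⇒length≤k : ∀ {xs : List C} → Unique xs → length xs ≤ k
  unique⇒length≤k {xs} u = subst (length xs ≤_) (length-tabulate {n = k} (λ i → i)) (⊆⇒length≤ u (λ {x} _ → ∈-allFin x))

  fresh : (X : List C) → length X < k → ∃[ c ] c ∉ X
  fresh X lt with anyF? (λ c → ¬? (_∈?_ _≟F_ c X))
  ... | yes p = p
  ... | no none = contradiction
    (subst (_≤ length X) (length-tabulate {n = k} (λ i → i)) (⊆⇒length≤ (allFin⁺ k) sub)) (<⇒≱ lt)
    where
    sub : allFin k ⊆ X
    sub {c} _ = decidable-stable (_∈?_ _≟F_ c X) (λ c∉ → none (c , c∉))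

  pick : ∀ n X → n + length X ≤ k → ∃[ L ] length L ≡ n × Unique L × L # X
  pick zero X le = [] , refl , [] , λ ()
  pick (suc n) X le
    with c , c∉X ← fresh X (≤-trans (s≤s (m≤n+m _ n)) le)
    with L , eq , u , d ← pick n (c ∷ X) (subst (_≤ k) (sym (+-suc n (length X))) le) =
      c ∷ L , cong suc eq , unique-∷ (λ p → d p (here refl)) u , ∷-# c∉X (λ p q → d p (there q))

  Meet : List C → List C → Set
  Meet R L = ∃[ z ] z ∈ R × z ∈ L

  Meet-sym : ∀ {R L} → Meet R L → Meet L R
  Meet-sym (z , p , q) = z , q , p

  -- The two sides of an apex receive disjoint lists, one meeting `R` and the other meeting `S`.
  -- Nonempty `R` and `S` have distinct representatives unless both are the same singleton.
  Apart : List C → List C → Set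
  Apart R L = ∀ {x y} → R ≡ [ x ] → L ≡ [ y ] → x ≢ y

  -- Three of the six colours belong to the triangle. If `R` is a pair disjoint from a nonempty `S`,
  -- then these three, `R` and a representative of `S` exhaust the palette, and `seeds-left` finds
  -- no separator.
  Tight : List C → List C → Set
  Tight R L = k ≡ 6 → (length R ≡ 2 → 0 < length L → Meet R L) × (length L ≡ 2 → 0 < length R → Meet R L)

  -- The state of an edge ab whose far side has an apex: P and Q are the colours reserved for the
  -- neighbours of a and of b beyond ab, and τ is the colour of the apex.  In the two configurations
  -- excluded by Apart and Tight the neighbours of the apex could not be coloured.
  record Inv (Ex : Set) (P Q : List C) : Set where
    constructor inv
    field
      τ : C
      R S : List C
      P≡ : P ≡ τ ∷ R
      Q≡ : Q ≡ τ ∷ S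
      apart : Ex ⊎ Apart R S
      tight : Tight R S

  Tight-sym : ∀ {R S} → Tight R S → Tight S R
  Tight-sym t eq with f , g ← t eq = (λ l m → Meet-sym (g l m)) , (λ l m → Meet-sym (f l m))

  Inv-sym : ∀ {Ex P Q} → Inv Ex P Q → Inv Ex Q P
  Inv-sym (inv τ R S P≡ Q≡ (inj₁ e) t) = inv τ S R Q≡ P≡ (inj₁ e) (Tight-sym t)
  Inv-sym (inv τ R S P≡ Q≡ (inj₂ a) t) = inv τ S R Q≡ P≡ (inj₂ λ e f g → a f e (sym g)) (Tight-sym t)

  -- `Inv` wants the shared colour at the head, so a reserved list may have to be permuted first.
  -- Distinctness, equal length and inclusion together make `P₁` a permutation of `P`.
  record Reorder (P P₁ : List C) : Set where
    constructor reorder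
    field
      uniq : Unique P₁
      size : length P₁ ≡ length P
      sub  : P₁ ⊆ P

  extract-reorder : ∀ {x P} → x ∈ P → Unique P → ∃[ R ] Reorder P (x ∷ R) × P ⊆ x ∷ R
  extract-reorder x∈ u with R , u′ , eq , sub , sup ← extract x∈ u = R , reorder u′ (sym eq) sub , sup

  record Fill (X A B : List C) (p q : ℕ) : Set where
    constructor filled
    field
      A⁺ B⁺ : List C
    L : List C
    L = A ++ A⁺
    M : List C
    M = B ++ B⁺
    field
      lenL : length L ≡ p
      lenM : length M ≡ q
      uL : Unique L
      uM : Unique M
      L#X : L # X
      M#X : M # X
      L#M : L # M

  abstract
    -- The list on the left is completed first, avoiding `B` as well as `X`; the list on the right
    -- then avoids the completed one, which makes the two disjoint.
    fill : ∀ X A B p q → Unique A → Unique B → A # X → B # X → A # B →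
      length A ≤ p → length B ≤ q → length X + (p + q) ≤ k → Fill X A B p q
    fill X A B p q uA uB A#X B#X A#B a≤p b≤q le
      with A⁺ , lenA , uA⁺ , dA ← pick (p ∸ length A) (X ++ A ++ B)
        (subst (_≤ k) (sym (cong (p ∸ length A +_) (trans (length-++ X) (cong (length X +_) (length-++ A)))))
          (fill-room (length X) a≤p b≤q le))
      with B⁺ , lenB , uB⁺ , dB ← pick (q ∸ length B) (X ++ (A ++ A⁺) ++ B)
        (subst (_≤ k) (sym (cong (q ∸ length B +_) (trans (length-++ X) (cong (length X +_)
            (trans (length-++ (A ++ A⁺)) (cong (_+ length B) (trans (length-++ A) (trans (cong (length A +_) lenA) (m+[n∸m]≡n a≤p)))))))))
          (fill-room (length X) b≤q ≤-refl (subst (λ z → length X + z ≤ k) (+-comm p q) le)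
            |> subst (λ z → q ∸ length B + (length X + z) ≤ k) (+-comm (length B) p)))
      = filled A⁺ B⁺
          (trans (length-++ A) (trans (cong (length A +_) lenA) (m+[n∸m]≡n a≤p)))
          (trans (length-++ B) (trans (cong (length B +_) lenB) (m+[n∸m]≡n b≤q)))
          (++⁺ uA uA⁺ λ (s , t) → dA t (∈-++⁺ʳ X (∈-++⁺ˡ s)))
          (++⁺ uB uB⁺ λ (s , t) → dB t (∈-++⁺ʳ X (∈-++⁺ʳ (A ++ A⁺) s)))
          (++-# A#X λ s t → dA s (∈-++⁺ˡ t))
          (++-# B#X λ s t → dB s (∈-++⁺ˡ t))
          (#-++ (++-# A#B λ s t → dA s (∈-++⁺ʳ X (∈-++⁺ʳ A t))) λ s t → dB t (∈-++⁺ʳ X (∈-++⁺ˡ s)))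

  -- When two lists of length 2 both contain ρ, Apart has to be ensured by a colour δ outside R.
  Needs : List C → ℕ → Set
  Needs R p = length R ≡ 2 × p ≡ 2

  needs? : ∀ R p → Dec (Needs R p)
  needs? R p = (length R ≟ 2) ×-dec (p ≟ 2)

  Good : List C → ℕ → List C → Set
  Good R p δs = k ≤ 5 ⊎ (Needs R p → ∃[ δ ] δs ≡ [ δ ] × δ ∉ R)

  -- The prefix of a list that is fixed before free colours are drawn: a colour `ρ` shared with `R`,
  -- then a separator `δ` if `Good` demands one. Without an apex (`¬ F`) nothing has to be shared.
  data Seed (F : Set) (R : List C) (p : ℕ) : List C → Set where
    unseeded : ¬ F → Seed F R p []
    seeded : ∀ {ρ δs} → ρ ∈ R → Good R p δs → Seed F R p (ρ ∷ δs)

  record Seeds (X R S : List C) (p q : ℕ) (FL FR : Set) : Set where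
    constructor seeds
    field
      {A B} : List C
      seedL : Seed FL R p A
      seedR : Seed FR S q B
      uA : Unique A
      uB : Unique B
      A#X : A # X
      B#X : B # X
      A#B : A # B
      A≤p : length A ≤ p
      B≤q : length B ≤ q

  swapSeeds : ∀ {X R S p q FL FR} → Seeds X R S p q FL FR → Seeds X S R q p FR FL
  swapSeeds (seeds sL sR uA uB A#X B#X A#B A≤p B≤q) = seeds sR sL uB uA B#X A#X (#-sym A#B) B≤q A≤p

  -- If a colour `y` of `L` lay outside `R`, then `y`, `ρ`, the two colours of `R` and three of `X`
  -- would be seven distinct colours out of six.
  room⇒tight : ∀ {X ρ R L} → 3 ≤ length X → Unique X → Unique (ρ ∷ R) → Unique (ρ ∷ L) →
    ρ ∷ R # X → ρ ∷ L # X → Tight R L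
  room⇒tight {X} 3≤X uX uR uL R#X L#X refl =
    half uR uL R#X L#X , (λ eq pos → Meet-sym (half uL uR L#X R#X eq pos))
    where
    half : ∀ {ρ R L} → Unique (ρ ∷ R) → Unique (ρ ∷ L) → ρ ∷ R # X → ρ ∷ L # X →
      length R ≡ 2 → 0 < length L → Meet R L
    half {ρ} {R} {y ∷ L} uR uL R#X L#X eq pos with _∈?_ _≟F_ y R
    ... | yes y∈R = y , y∈R , here refl
    ... | no y∉R = contradiction
        (unique⇒length≤k (++⁺ (unique-∷ y∉ uR) uX λ (s , t) → ∷-# (L#X (there (here refl))) R#X s t))
        (<⇒≱ (subst (7 ≤_) (sym (trans (length-++ (y ∷ ρ ∷ R)) (cong (λ l → 2 + l + length X) eq))) (+-monoʳ-≤ 4 3≤X)))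
      where
      y∉ : y ∉ ρ ∷ R
      y∉ (here refl) = head∉tail uL (here refl)
      y∉ (there p) = y∉R p

  -- `FL` and `FR` stand for the existence of a further apex over the left and the right edge; an
  -- invariant is owed only then. In `invR` the list `M` comes first because the apex is the left
  -- end of that edge.
  record Choice (X R S : List C) (p q : ℕ) (FL FR ExL ExR : Set) : Set where
    constructor choice
    field
      {R₁ S₁ L M} : List C
      reR : Reorder R R₁
      reS : Reorder S S₁
      lenL : length L ≡ p
      lenM : length M ≡ q
      uL : Unique L
      uM : Unique M
      L#X : L # X
      M#X : M # X
      L#M : L # M
      invL : FL → Inv ExL R₁ L
      invR : FR → Inv ExR M S₁

  Reorder-refl : ∀ {P} → Unique P → Reorder P P
  Reorder-refl u = reorder u refl (λ z → z)

  -- `Tight` is a matter of counting, by `room⇒tight`. `Apart` could fail only for two singleton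
  -- tails; then `Needs` holds, so the second tail consists of the separator `δ`, which lies outside
  -- `R`. For `k ≤ 5` the exemption takes its place.
  grow-seed : ∀ {X R p F Ex A} A⁺ → (k ≤ 5 → Ex) → 3 ≤ length X → Unique X → Unique R → R # X →
    Seed F R p A → Unique (A ++ A⁺) → A ++ A⁺ # X → length (A ++ A⁺) ≡ p →
    ∃[ R₁ ] Reorder R R₁ × (F → Inv Ex R₁ (A ++ A⁺))
  grow-seed A⁺ ex 3≤X uX uR R#X (unseeded ¬f) uL L#X len = _ , Reorder-refl uR , λ f → contradiction f ¬f
  grow-seed {R = R} {p} {F} {Ex} A⁺ ex 3≤X uX uR R#X (seeded {ρ} {δs} ρ∈ good) uL L#X len
    with R′ , re , _ ← extract-reorder ρ∈ uR =
      ρ ∷ R′ , re , λ _ → inv ρ R′ (δs ++ A⁺) refl refl (apart good)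
        (room⇒tight 3≤X uX (Reorder.uniq re) uL (λ s → R#X (Reorder.sub re s)) L#X)
    where
    clash : ∀ {x y} → δs ++ A⁺ ≡ [ y ] → x ≡ y → x ∈ R → ∃[ δ ] δs ≡ [ δ ] × δ ∉ R → ⊥
    clash eq refl x∈R (δ , refl , δ∉R) = δ∉R (subst (_∈ R) (sym (∷-injectiveˡ eq)) x∈R)
    far : (Needs R p → ∃[ δ ] δs ≡ [ δ ] × δ ∉ R) → Apart R′ (δs ++ A⁺)
    far g R′≡ L≡ x≡y = clash L≡ x≡y
      (Reorder.sub re (there (subst (_ ∈_) (sym R′≡) (here refl))))
      (g ( trans (sym (Reorder.size re)) (cong (λ z → suc (length z)) R′≡)
         , trans (sym len) (cong (λ z → suc (length z)) L≡)))
    apart : Good R p δs → Ex ⊎ Apart R′ (δs ++ A⁺)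
    apart (inj₁ k≤5) = inj₁ (ex k≤5)
    apart (inj₂ g) = inj₂ (far g)

  grow : ∀ {X R S p q FL FR ExL ExR} → (k ≤ 5 → ExL) → (k ≤ 5 → ExR) →
    3 ≤ length X → Unique X → Unique R → Unique S → R # X → S # X → length X + (p + q) ≤ k →
    Seeds X R S p q FL FR → Choice X R S p q FL FR ExL ExR
  grow {X} {R} {S} {p} {q} {FL} {FR} {ExL} {ExR} exL exR 3≤X uX uR uS R#X S#X le
    (seeds {A} {B} sL sR uA uB A#X B#X A#B A≤p B≤q) =
    choice (proj₁ (proj₂ left)) (proj₁ (proj₂ right)) lenL lenM uL uM L#X M#X L#M
      (proj₂ (proj₂ left)) (λ f → Inv-sym (proj₂ (proj₂ right) f))
    where
    open Fill (fill X A B p q uA uB A#X B#X A#B A≤p B≤q le)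
    left : ∃[ R₁ ] Reorder R R₁ × (FL → Inv ExL R₁ L)
    left = grow-seed A⁺ exL 3≤X uX uR R#X sL uL L#X lenL
    right : ∃[ S₁ ] Reorder S S₁ × (FR → Inv ExR S₁ M)
    right = grow-seed B⁺ exR 3≤X uX uS S#X sR uM M#X lenM

  distinct-pair : ∀ {R S} → Unique R → Unique S → 0 < length R → 0 < length S → Apart R S →
    ∃[ ρ ] ∃[ σ ] ρ ∈ R × σ ∈ S × ρ ≢ σ
  distinct-pair {ρ ∷ R} {σ ∷ S} uR uS _ _ apart with ρ ≟F σ
  ... | no ρ≢σ = ρ , σ , here refl , here refl , ρ≢σ
  distinct-pair {ρ ∷ R} {σ ∷ s ∷ S} uR uS _ _ apart | yes refl =
    ρ , s , here refl , there (here refl) , λ eq → head∉tail uS (here eq)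
  distinct-pair {ρ ∷ r ∷ R} {σ ∷ []} uR uS _ _ apart | yes refl =
    r , σ , there (here refl) , here refl , λ eq → head∉tail uR (here (sym eq))
  distinct-pair {ρ ∷ []} {σ ∷ []} uR uS _ _ apart | yes refl = contradiction refl (apart refl refl)

  meet? : ∀ R S → Dec (Meet R S)
  meet? R S with any? (λ c → _∈?_ _≟F_ c S) R
  ... | yes p = yes (find p)
  ... | no ¬p = no λ (z , z∈R , z∈S) → ¬p (lose z∈R z∈S)

  ∉-cons : ∀ {x y : C} {xs} → x ≢ y → x ∉ xs → x ∉ y ∷ xs
  ∉-cons n m (here eq) = n eq
  ∉-cons n m (there p) = m p

  ∉⇒≢ : ∀ {x y : C} {xs} → x ∉ xs → y ∈ xs → x ≢ y
  ∉⇒≢ n p refl = n p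

  single-# : ∀ {x : C} {xs} → x ∉ xs → [ x ] # xs
  single-# n = ∷-# n λ ()

  pair-# : ∀ {x y : C} {xs} → x ∉ xs → y ∉ xs → x ∷ y ∷ [] # xs
  pair-# n m = ∷-# n (single-# m)

  unique-pair : ∀ {x y : C} → x ≢ y → Unique (x ∷ y ∷ [])
  unique-pair n = unique-∷ (∉-cons n λ ()) (unique-∷ (λ ()) [])

  unique-single : ∀ {x : C} → Unique [ x ]
  unique-single = unique-∷ (λ ()) []

  fresh₂ : ∀ X Y → length X + length Y < k → ∃[ c ] c ∉ X × c ∉ Y
  fresh₂ X Y lt with c , c∉ ← fresh (X ++ Y) (subst (_< k) (sym (length-++ X)) lt) =
    c , (λ p → c∉ (∈-++⁺ˡ p)) , (λ p → c∉ (∈-++⁺ʳ X p))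

  member : ∀ {R : List C} → 0 < length R → ∃[ c ] c ∈ R
  member {c ∷ _} _ = c , here refl

  record PairWith (z : C) (R : List C) : Set where
    constructor pair-with
    field
      other : C
      other∈ : other ∈ R
      ≢other : z ≢ other
      cover : ∀ {c} → c ∈ R → c ∈ z ∷ other ∷ []

  pair-of : ∀ {z R} → length R ≡ 2 → Unique R → z ∈ R → PairWith z R
  pair-of len u z∈ with extract z∈ u
  ... | [] , _ , eq , _ = contradiction (trans (sym len) eq) λ ()
  ... | β ∷ [] , u′ , _ , sub , sup = pair-with β (sub (there (here refl))) (λ eq → head∉tail u′ (here eq)) sup
  ... | _ ∷ _ ∷ _ , _ , eq , _ = contradiction (trans (sym len) eq) λ ()

  module _ {X R S : List C} {p q : ℕ} {FL FR : Set} (X≡3 : length X ≡ 3) (uR : Unique R) (uS : Unique S)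
    (R#X : R # X) (S#X : S # X) (R≢[] : 0 < length R) (S≢[] : 0 < length S) (0<p : 0 < p) (0<q : 0 < q) where

    fresh₃ : ∀ Y → 3 + length Y < k → ∃[ c ] c ∉ X × c ∉ Y
    fresh₃ Y lt = fresh₂ X Y (subst (λ l → l + length Y < k) (sym X≡3) lt)

    seeds-apart : (k ≤ 5 ⊎ ¬ Needs R p) → (k ≤ 5 ⊎ ¬ Needs S q) → Apart R S → Seeds X R S p q FL FR
    seeds-apart nR nS apart with ρ , σ , ρ∈ , σ∈ , ρ≢σ ← distinct-pair uR uS R≢[] S≢[] apart =
      seeds (seeded ρ∈ (weaken nR)) (seeded σ∈ (weaken nS)) unique-single unique-single
        (single-# (R#X ρ∈)) (single-# (S#X σ∈)) (single-# (∉-cons ρ≢σ λ ())) 0<p 0<q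
      where
      weaken : ∀ {R p δs} → k ≤ 5 ⊎ ¬ Needs R p → Good R p δs
      weaken (inj₁ k≤5) = inj₁ k≤5
      weaken (inj₂ ¬n) = inj₂ λ n → contradiction n ¬n

    -- If `R` and `S` meet, the colour shared with `S` is taken inside `R`, and the separator has to
    -- avoid only the five colours of `X` and `R`. Otherwise `Tight` rules out `k = 6`, and with
    -- seven colours six forbidden ones are affordable.
    seeds-left : 6 ≤ k → Needs R p → ¬ Needs S q → Tight R S → Seeds X R S p q FL FR
    seeds-left 6≤k (R≡2 , refl) ¬nS tight with meet? R S
    ... | yes (z , z∈R , z∈S)
      with pair-with β β∈R z≢β R⊆ ← pair-of R≡2 uR z∈R
      with δ , δ∉X , δ∉R ← fresh₃ (z ∷ β ∷ []) 6≤k =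
        seeds (seeded β∈R (inj₂ λ _ → δ , refl , λ s → δ∉R (R⊆ s))) (seeded z∈S (inj₂ λ n → contradiction n ¬nS))
          (unique-pair (λ eq → δ∉R (there (here (sym eq))))) unique-single
          (pair-# (R#X β∈R) δ∉X) (single-# (S#X z∈S))
          (pair-# (∉-cons (λ eq → z≢β (sym eq)) λ ()) (∉-cons (∉⇒≢ δ∉R (here refl)) λ ())) ≤-refl 0<q
    ... | no ¬meet with member R≢[] | member S≢[] | m≤n⇒m<n∨m≡n 6≤k
    ... | α , α∈R | σ , σ∈S | inj₂ 6≡k = contradiction (proj₁ (tight (sym 6≡k)) R≡2 S≢[]) ¬meet
    ... | α , α∈R | σ , σ∈S | inj₁ 7≤k
      with δ , δ∉X , δ∉ ← fresh₃ (σ ∷ R) (subst (λ l → 4 + l < k) (sym R≡2) 7≤k) =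
        seeds (seeded α∈R (inj₂ λ _ → δ , refl , λ s → δ∉ (there s))) (seeded σ∈S (inj₂ λ n → contradiction n ¬nS))
          (unique-pair (λ { refl → δ∉ (there α∈R) })) unique-single
          (pair-# (R#X α∈R) δ∉X) (single-# (S#X σ∈S))
          (pair-# (∉-cons (λ { refl → ¬meet (α , α∈R , σ∈S) }) λ ()) (∉-cons (∉⇒≢ δ∉ (here refl)) λ ())) ≤-refl 0<q

    -- Disjoint pairs supply each other's separators. If the pairs share `z`, the left seed starts
    -- with the other colour of `R` and the right one with `z`; every fresh separator then avoids at
    -- most six colours.
    seeds-both : 7 ≤ k → Needs R p → Needs S q → Seeds X R S p q FL FR
    seeds-both 7≤k (R≡2 , refl) (S≡2 , refl) with meet? R S
    ... | no ¬meet
      with α , α∈R ← member R≢[]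
      with γ , γ∈S ← member S≢[]
      with pair-with β β∈R α≢β _ ← pair-of R≡2 uR α∈R
      with pair-with ε ε∈S γ≢ε _ ← pair-of S≡2 uS γ∈S =
        seeds (seeded α∈R (inj₂ λ _ → ε , refl , λ s → ¬meet (ε , s , ε∈S)))
          (seeded γ∈S (inj₂ λ _ → β , refl , λ s → ¬meet (β , β∈R , s)))
          (unique-pair (apart α∈R ε∈S)) (unique-pair (λ eq → apart β∈R γ∈S (sym eq)))
          (pair-# (R#X α∈R) (S#X ε∈S)) (pair-# (S#X γ∈S) (R#X β∈R))
          (pair-# (∉-cons (apart α∈R γ∈S) (∉-cons α≢β λ ()))
            (∉-cons (λ eq → γ≢ε (sym eq)) (∉-cons (λ eq → apart β∈R ε∈S (sym eq)) λ ())))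
          ≤-refl ≤-refl
      where
      apart : ∀ {x y} → x ∈ R → y ∈ S → x ≢ y
      apart x∈R y∈S refl = ¬meet (_ , x∈R , y∈S)
    seeds-both 7≤k (R≡2 , refl) (S≡2 , refl) | yes (z , z∈R , z∈S)
      with pair-with β β∈R z≢β R⊆ ← pair-of R≡2 uR z∈R
      with pair-with γ γ∈S z≢γ S⊆ ← pair-of S≡2 uS z∈S
      with β ≟F γ
    ... | yes refl
      with δ , δ∉X , δ∉ ← fresh₃ (z ∷ β ∷ []) (≤-trans (n≤1+n _) 7≤k)
      with ε , ε∉X , ε∉ ← fresh₃ (δ ∷ z ∷ β ∷ []) 7≤k =
        seeds (seeded β∈R (inj₂ λ _ → δ , refl , λ s → δ∉ (R⊆ s)))
          (seeded z∈S (inj₂ λ _ → ε , refl , λ s → ε∉ (there (S⊆ s))))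
          (unique-pair (λ eq → δ∉ (there (here (sym eq))))) (unique-pair (λ eq → ε∉ (there (here (sym eq)))))
          (pair-# (R#X β∈R) δ∉X) (pair-# (S#X z∈S) ε∉X)
          (pair-# (∉-cons (λ eq → z≢β (sym eq)) (∉-cons (λ eq → ε∉ (there (there (here (sym eq))))) λ ()))
            (∉-cons (∉⇒≢ δ∉ (here refl)) (∉-cons (λ eq → ε∉ (here (sym eq))) λ ())))
          ≤-refl ≤-refl
    ... | no β≢γ
      with ε , ε∉X , ε∉ ← fresh₃ (z ∷ β ∷ γ ∷ []) 7≤k =
        seeds (seeded β∈R (inj₂ λ _ → γ , refl , λ s → ∉-cons (λ eq → z≢γ (sym eq)) (∉-cons (λ eq → β≢γ (sym eq)) λ ()) (R⊆ s)))
          (seeded z∈S (inj₂ λ _ → ε , refl , λ s → ∉-cons (∉⇒≢ ε∉ (here refl)) (∉-cons (∉⇒≢ ε∉ (there (there (here refl)))) λ ()) (S⊆ s)))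
          (unique-pair β≢γ) (unique-pair (λ eq → ε∉ (here (sym eq))))
          (pair-# (R#X β∈R) (S#X γ∈S)) (pair-# (S#X z∈S) ε∉X)
          (pair-# (∉-cons (λ eq → z≢β (sym eq)) (∉-cons (λ eq → ε∉ (there (here (sym eq)))) λ ()))
            (∉-cons (λ eq → z≢γ (sym eq)) (∉-cons (λ eq → ε∉ (there (there (here (sym eq))))) λ ())))
          ≤-refl ≤-refl

  seeds-one : ∀ {X R S p q FL FR} → length X ≡ 3 → Unique R → R # X → ¬ FR → 0 < length R → 0 < p → Seeds X R S p q FL FR
  seeds-one {X} {ρ ∷ R} {p = p} X≡3 uR R#X ¬fR _ 0<p with 6 ≤? k | needs? (ρ ∷ R) p
  ... | yes 6≤k | yes (R≡2 , refl)
    with δ , δ∉X , δ∉R ← fresh₂ X (ρ ∷ R) (subst (_< k) (sym (cong₂ _+_ X≡3 R≡2)) 6≤k) =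
      seeds (seeded (here refl) (inj₂ λ _ → δ , refl , δ∉R)) (unseeded ¬fR)
        (unique-pair (λ eq → δ∉R (here (sym eq)))) [] (pair-# (R#X (here refl)) δ∉X) (λ ()) (λ _ ()) ≤-refl z≤n
  ... | yes _ | no ¬n =
      seeds (seeded (here refl) (inj₂ λ n → contradiction n ¬n)) (unseeded ¬fR)
        unique-single [] (single-# (R#X (here refl))) (λ ()) (λ _ ()) 0<p z≤n
  ... | no k≱6 | _ =
      seeds (seeded (here refl) (inj₁ (≤-pred (≰⇒> k≱6)))) (unseeded ¬fR)
        unique-single [] (single-# (R#X (here refl))) (λ ()) (λ _ ()) 0<p z≤n

  seeds-two : ∀ {X R S p q FL FR} → length X ≡ 3 → Unique R → Unique S → R # X → S # X →
    0 < length R → 0 < p → 0 < length S → 0 < q → 3 + (p + q) ≤ k → Apart R S → Tight R S → Seeds X R S p q FL FR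
  seeds-two {X} {R} {S} {p} {q} X≡3 uR uS R#X S#X 0<R 0<p 0<S 0<q le apart tight
    with 6 ≤? k | needs? R p | needs? S q
  ... | no k≱6 | _ | _ = seeds-apart X≡3 uR uS R#X S#X 0<R 0<S 0<p 0<q (inj₁ k≤5) (inj₁ k≤5) apart
    where k≤5 = ≤-pred (≰⇒> k≱6)
  ... | yes _ | no nR | no nS = seeds-apart X≡3 uR uS R#X S#X 0<R 0<S 0<p 0<q (inj₂ nR) (inj₂ nS) apart
  ... | yes 6≤k | yes nR | no nS = seeds-left X≡3 uR uS R#X S#X 0<R 0<S 0<p 0<q 6≤k nR nS tight
  ... | yes 6≤k | no nR | yes nS = swapSeeds (seeds-left X≡3 uS uR S#X R#X 0<S 0<R 0<q 0<p 6≤k nS nR (Tight-sym tight))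
  -- Here `p` and `q` are both 2, so `le` reads `7 ≤ k`.
  ... | yes 6≤k | yes nR@(_ , refl) | yes nS@(_ , refl) = seeds-both X≡3 uR uS R#X S#X 0<R 0<S 0<p 0<q le nR nS

  choose : ∀ {X R S p q FL FR ExL ExR} → Dec FL → Dec FR → (k ≤ 5 → ExL) → (k ≤ 5 → ExR) →
    length X ≡ 3 → Unique X → Unique R → Unique S → R # X → S # X → 3 + (p + q) ≤ k →
    (FL → 0 < length R × 0 < p) → (FR → 0 < length S × 0 < q) → (FL → FR → Apart R S) → Tight R S →
    Choice X R S p q FL FR ExL ExR
  choose {X} {R} {S} {p} {q} {FL} {FR} dL dR exL exR X≡3 uX uR uS R#X S#X le posL posR apart tight =
    grow exL exR (≤-reflexive (sym X≡3)) uX uR uS R#X S#X (subst (λ l → l + (p + q) ≤ k) (sym X≡3) le) (go dL dR)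
    where
    go : Dec FL → Dec FR → Seeds X R S p q FL FR
    go (yes fL) (yes fR) = seeds-two X≡3 uR uS R#X S#X (proj₁ (posL fL)) (proj₂ (posL fL)) (proj₁ (posR fR)) (proj₂ (posR fR)) le (apart fL fR) tight
    go (yes fL) (no ¬fR) = seeds-one X≡3 uR R#X ¬fR (proj₁ (posL fL)) (proj₂ (posL fL))
    go (no ¬fL) (yes fR) = swapSeeds (seeds-one X≡3 uS S#X ¬fL (proj₁ (posR fR)) (proj₂ (posR fR)))
    go (no ¬fL) (no ¬fR) = seeds (unseeded ¬fL) (unseeded ¬fR) [] [] (λ ()) (λ ()) (λ ()) z≤n z≤n

  -- This serves an edge from an end of a piece to an inner neighbour, where only one side owes an
  -- invariant. As `X` has just two colours, `room⇒tight` does not apply; a second colour `r` common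
  -- to both lists gives `Tight` instead, and two pairs are kept apart by a separator.
  choose-root : ∀ {X R p q F Ex} → Dec F → (k ≤ 4 → Ex) → length X ≡ 2 → Unique R → R # X →
    2 + (p + q) ≤ k → (F → 0 < length R × 0 < p) → Choice X R [] p q F ⊥ Ex ⊥
  choose-root {X} {R} {p} {q} {F} {Ex} dF ex X≡2 uR R#X le pos = go dF
    where
    expand : ∀ A → Unique A → A # X → length A ≤ p → Fill X A [] p q
    expand A uA A#X A≤p = fill X A [] p q uA [] A#X (λ ()) (λ _ ()) A≤p z≤n (subst (λ l → l + (p + q) ≤ k) (sym X≡2) le)

    build : ∀ {A} (f : Fill X A [] p q) → (F → Inv Ex R (Fill.L f)) → Choice X R [] p q F ⊥ Ex ⊥
    build f i = choice (Reorder-refl uR) (Reorder-refl []) lenL lenM uL uM L#X M#X L#M i (λ ())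
      where open Fill f

    start : ∀ {R′ ρ} → R ≡ ρ ∷ R′ → 0 < p → Choice X R [] p q F ⊥ Ex ⊥
    start {R′} {ρ} refl 0<p with needs? R p | 5 ≤? k
    ... | yes (R≡2 , refl) | yes 5≤k
      with δ , δ∉X , δ∉R ← fresh₂ X R (subst (_< k) (sym (cong₂ _+_ X≡2 R≡2)) 5≤k)
      with f ← expand (ρ ∷ δ ∷ []) (unique-pair (λ eq → δ∉R (here (sym eq)))) (pair-# (R#X (here refl)) δ∉X) ≤-refl =
        build f λ _ → inv ρ R′ (δ ∷ Fill.A⁺ f) refl refl
          (inj₂ λ { refl refl refl → δ∉R (there (here refl)) })
          -- Both tails have length one, so the premises of `Tight` fail.
          (λ _ → (λ R′≡2 → contradiction (trans (sym R≡2) (cong suc R′≡2)) λ ())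
               , (λ L′≡2 → contradiction (trans (sym (Fill.lenL f)) (cong suc L′≡2)) λ ()))
    ... | yes _ | no k≱5
      with f ← expand [ ρ ] unique-single (single-# (R#X (here refl))) 0<p =
        build f λ _ → inv ρ R′ (Fill.A⁺ f) refl refl (inj₁ (ex (≤-pred (≰⇒> k≱5))))
          (λ { refl → contradiction (s≤s (s≤s (s≤s (s≤s (s≤s z≤n))))) k≱5 })
    ... | no ¬n | _ = spread refl ¬n 0<p
      where
      spread : ∀ {R″} → R′ ≡ R″ → ¬ Needs (ρ ∷ R″) p → 0 < p → Choice X R [] p q F ⊥ Ex ⊥
      spread {r ∷ R″} refl ¬n 0<p with 2 ≤? p
      ... | yes 2≤p
        with f ← expand (ρ ∷ r ∷ []) (unique-pair λ eq → head∉tail uR (here eq)) (pair-# (R#X (here refl)) (R#X (there (here refl)))) 2≤p =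
          build f λ _ → inv ρ R′ (r ∷ Fill.A⁺ f) refl refl
            (inj₂ λ { refl L≡ _ → ¬n (refl , trans (sym (Fill.lenL f)) (cong (λ l → suc (length l)) L≡)) })
            (λ _ → (λ _ _ → r , here refl , here refl) , (λ _ _ → r , here refl , here refl))
      -- Now `p` is 1, the tail of the new list is empty, and both conditions are vacuous.
      ... | no p≱2
        with f ← expand [ ρ ] unique-single (single-# (R#X (here refl))) 0<p =
          build f λ _ → inv ρ R′ (Fill.A⁺ f) refl refl
            (inj₂ λ { _ L≡ _ → p≱2 (≤-reflexive (sym (trans (sym (Fill.lenL f)) (cong (λ l → suc (length l)) L≡)))) })
            (λ _ → (λ _ 0<L → contradiction (≤-trans (s≤s 0<L) (≤-reflexive (Fill.lenL f))) p≱2)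
                 , (λ L≡2 _ → contradiction (≤-trans (s≤s (≤-trans (s≤s z≤n) (≤-reflexive (sym L≡2)))) (≤-reflexive (Fill.lenL f))) p≱2))
      spread {[]} refl ¬n 0<p
        with f ← expand [ ρ ] unique-single (single-# (R#X (here refl))) 0<p =
          build f λ _ → inv ρ [] (Fill.A⁺ f) refl refl (inj₂ λ ()) (λ _ → (λ ()) , (λ _ ()))

    nonempty : 0 < length R → ∃[ ρ ] ∃[ R′ ] R ≡ ρ ∷ R′
    nonempty 0<R = split R refl 0<R
      where
      split : ∀ Y → R ≡ Y → 0 < length Y → ∃[ ρ ] ∃[ R′ ] R ≡ ρ ∷ R′
      split (ρ ∷ R′) eq _ = ρ , R′ , eq

    go : Dec F → Choice X R [] p q F ⊥ Ex ⊥
    go (no ¬f) = build (expand [] [] (λ ()) z≤n) (λ f → contradiction f ¬f)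
    go (yes f) = start (proj₂ (proj₂ (nonempty (proj₁ (pos f))))) (proj₂ (pos f))

-- Noncrossing chordal graphs on the line

module _ {P : ℕ → Set} (P? : ∀ i → Dec (P i)) where

  rightmost : ∀ lo hi → (∃[ i ] lo < i × i < hi × P i × (∀ {j} → i < j → j < hi → ¬ P j))
    ⊎ (∀ {i} → lo < i → i < hi → ¬ P i)
  rightmost lo zero = inj₂ λ _ ()
  rightmost lo (suc h) with (lo <? h) ×-dec P? h
  ... | yes (lo<h , ph) = inj₁ (h , lo<h , ≤-refl , ph , λ h<j j≤h → contradiction (≤-pred j≤h) (<⇒≱ h<j))
  ... | no ¬h with rightmost lo h
  ... | inj₁ (i , lo<i , i<h , pi , max) = inj₁ (i , lo<i , m<n⇒m<1+n i<h , pi , max′)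
    where
    max′ : ∀ {j} → i < j → j < suc h → ¬ P j
    max′ i<j j≤h pj with m≤n⇒m<n∨m≡n (≤-pred j≤h)
    ... | inj₁ j<h = max i<j j<h pj
    ... | inj₂ refl = ¬h (<-trans lo<i i<j , pj)
  ... | inj₂ none = inj₂ none′
    where
    none′ : ∀ {j} → lo < j → j < suc h → ¬ P j
    none′ lo<j j≤h pj with m≤n⇒m<n∨m≡n (≤-pred j≤h)
    ... | inj₁ j<h = none lo<j j<h pj
    ... | inj₂ refl = ¬h (lo<j , pj)

  leftmost : ∀ lo hi → (∃[ i ] lo < i × i < hi × P i × (∀ {j} → lo < j → j < i → ¬ P j))
    ⊎ (∀ {i} → lo < i → i < hi → ¬ P i)
  leftmost lo zero = inj₂ λ _ ()
  leftmost lo (suc h) with leftmost lo h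
  ... | inj₁ (i , lo<i , i<h , pi , min) = inj₁ (i , lo<i , m<n⇒m<1+n i<h , pi , min)
  ... | inj₂ none with (lo <? h) ×-dec P? h
  ... | yes (lo<h , ph) = inj₁ (h , lo<h , ≤-refl , ph , none)
  ... | no ¬h = inj₂ none′
    where
    none′ : ∀ {j} → lo < j → j < suc h → ¬ P j
    none′ lo<j j≤h pj with m≤n⇒m<n∨m≡n (≤-pred j≤h)
    ... | inj₁ j<h = none lo<j j<h pj
    ... | inj₂ refl = ¬h (lo<j , pj)

-- An outerplanar chordal graph whose vertices are natural numbers, drawn in this order on a circle.
-- Every number just after a non-isolated one is isolated, so there is always room to cut in between.
record Layout : Set where
  field
    E : ℕ → ℕ → Bool
  infix 4 _~_
  _~_ : ℕ → ℕ → Set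
  x ~ y = E x y ≡ true
  field
    ~-sym : ∀ {x y} → x ~ y → y ~ x
    ~-irrefl : ∀ {x} → ¬ x ~ x
    noncross : ∀ {a b c d} → a < c → c < b → b < d → a ~ b → ¬ c ~ d
    gap : ∀ {x y} → x ~ y → ∀ z → ¬ suc x ~ z
    chord : ∀ (w : ℕ → ℕ) m → 3 ≤ m → (∀ {i} → i < m → w i < w (suc i)) → (∀ {i} → i < m → w i ~ w (suc i)) →
      w 0 ~ w m → ∃[ i ] ∃[ j ] suc i < j × j ≤ m × ¬ (i ≡ 0 × j ≡ m) × w i ~ w j

  _~?_ : ∀ x y → Dec (x ~ y)
  x ~? y = E x y ≟ᵇ true

  nbrs : ℕ → ℕ → ℕ
  nbrs x zero = 0
  nbrs x (suc n) = if E x n then suc (nbrs x n) else nbrs x n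

  nbrs-adj : ∀ {x n} → x ~ n → nbrs x (suc n) ≡ suc (nbrs x n)
  nbrs-adj eq rewrite eq = refl

  nbrs-nonadj : ∀ {x n} → ¬ x ~ n → nbrs x (suc n) ≡ nbrs x n
  nbrs-nonadj {x} {n} ne with E x n
  ... | true = contradiction refl ne
  ... | false = refl

  nbrs-step : ∀ x n → nbrs x n ≤ nbrs x (suc n)
  nbrs-step x n with E x n
  ... | true = n≤1+n _
  ... | false = ≤-refl

  nbrs-mono : ∀ x {m n} → m ≤ n → nbrs x m ≤ nbrs x n
  nbrs-mono x {n = zero} z≤n = ≤-refl
  nbrs-mono x {n = suc n} m≤ with m≤n⇒m<n∨m≡n m≤
  ... | inj₁ m< = ≤-trans (nbrs-mono x (≤-pred m<)) (nbrs-step x n)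
  ... | inj₂ refl = ≤-refl

  nbrs-none : ∀ x {m n} → m ≤ n → (∀ {i} → m ≤ i → i < n → ¬ x ~ i) → nbrs x n ≡ nbrs x m
  nbrs-none x {n = zero} z≤n none = refl
  nbrs-none x {n = suc n} m≤ none with m≤n⇒m<n∨m≡n m≤
  ... | inj₁ m< = trans (nbrs-nonadj (none (≤-pred m<) ≤-refl)) (nbrs-none x (≤-pred m<) (λ l u → none l (m<n⇒m<1+n u)))
  ... | inj₂ refl = refl

  nbrs-some : ∀ {x m n i} → m ≤ i → i < n → x ~ i → nbrs x m < nbrs x n
  nbrs-some {x} m≤i i<n adj = ≤-trans (s≤s (nbrs-mono x m≤i)) (≤-trans (≤-reflexive (sym (nbrs-adj adj))) (nbrs-mono x i<n))

  Apex : ℕ → ℕ → Set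
  Apex a b = ∃[ t ] a < t × t < b × a ~ t × t ~ b

  apex? : ∀ a b → Dec (Apex a b)
  apex? a b with rightmost (λ t → (a ~? t) ×-dec (t ~? b)) a b
  ... | inj₁ (t , a<t , t<b , (p , q) , _) = yes (t , a<t , t<b , p , q)
  ... | inj₂ none = no λ (t , a<t , t<b , p , q) → none a<t t<b (p , q)

  Outer : ℕ → ℕ → Set
  Outer a b = ∃[ w ] (w < a ⊎ b < w) × a ~ w × b ~ w

  OnlyCross : ℕ → ℕ → ℕ → Set
  OnlyCross a b t = ∀ {x y} → a ≤ x → x < t → t < y → y ≤ b → x ~ y → x ≡ a × y ≡ b

  Cut : ℕ → ℕ → Set
  Cut a b = ∃[ t ] a < t × t < b × (∀ z → ¬ t ~ z) × OnlyCross a b t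

  module Walk {a b : ℕ} (a<b : a < b) (a~b : a ~ b) where

    Ahead : ℕ → ℕ → Set
    Ahead z i = z ~ i × ¬ (z ≡ a × i ≡ b)

    ahead? : ∀ z i → Dec (Ahead z i)
    ahead? z i = (z ~? i) ×-dec ¬? ((z ≟ a) ×-dec (i ≟ b))

    not-ahead : ∀ {z i} → ¬ Ahead z i → z ~ i → z ≡ a × i ≡ b
    not-ahead {z} {i} n adj = decidable-stable ((z ≟ a) ×-dec (i ≟ b)) (λ m → n (adj , m))

    -- The default `z` marks the end of the walk; `step-or-stuck` separates it from a genuine step.
    next : ℕ → ℕ
    next z = [ proj₁ , (λ _ → z) ]′ (rightmost (ahead? z) z (suc b))

    w : ℕ → ℕ
    w zero = a
    w (suc i) = next (w i)

    Stuck : ℕ → Set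
    Stuck z = ∀ {j} → z < j → j < suc b → ¬ Ahead z j

    Step : ℕ → Set
    Step z = z < next z × next z < suc b × Ahead z (next z) × (∀ {j} → next z < j → j < suc b → ¬ Ahead z j)

    step-or-stuck : ∀ z → Step z ⊎ Stuck z
    step-or-stuck z with rightmost (ahead? z) z (suc b)
    ... | inj₁ (_ , s) = inj₁ s
    ... | inj₂ n = inj₂ n

    Steps : ℕ → Set
    Steps m = ∀ {j} → j < m → Step (w j)

    steps-suc : ∀ {m} → Steps m → Step (w m) → Steps (suc m)
    steps-suc ss s j≤ with m≤n⇒m<n∨m≡n (≤-pred j≤)
    ... | inj₁ j< = ss j<
    ... | inj₂ refl = s

    run : ∀ fuel i → w i ≤ b → b ≤ fuel + w i → Steps i →
      ∃[ m ] Steps m × (w m ≡ b ⊎ w m < b × Stuck (w m))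
    run fuel i wi≤b enough ss with m≤n⇒m<n∨m≡n wi≤b
    run fuel i wi≤b enough ss | inj₂ eq = i , ss , inj₁ eq
    run zero i wi≤b enough ss | inj₁ lt = contradiction enough (<⇒≱ lt)
    run (suc fuel) i wi≤b enough ss | inj₁ lt with step-or-stuck (w i)
    ... | inj₁ s = run fuel (suc i) (≤-pred (proj₁ (proj₂ s)))
        (≤-trans enough (≤-trans (≤-reflexive (sym (+-suc fuel (w i)))) (+-monoʳ-≤ fuel (proj₁ s)))) (steps-suc ss s)
    ... | inj₂ st = i , ss , inj₂ (lt , st)

    increasing : ∀ {m i j} → Steps m → i < j → j ≤ m → w i < w j
    increasing {j = suc j} ss i<j j≤m with m≤n⇒m<n∨m≡n (≤-pred i<j)
    ... | inj₁ i<j′ = <-trans (increasing ss i<j′ (≤-trans (n≤1+n j) j≤m)) (proj₁ (ss j≤m))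
    ... | inj₂ refl = proj₁ (ss j≤m)

    locate : ∀ m {x} → Steps m → a ≤ x → x ≤ w m → x ≡ w m ⊎ (∃[ j ] j < m × w j ≤ x × x < w (suc j))
    locate zero ss a≤x x≤ = inj₁ (≤-antisym x≤ a≤x)
    locate (suc m) {x} ss a≤x x≤ with w m ≤? x | m≤n⇒m<n∨m≡n x≤
    ... | _ | inj₂ eq = inj₁ eq
    ... | yes le | inj₁ lt = inj₂ (m , ≤-refl , le , lt)
    ... | no nle | inj₁ _ with locate m (λ j< → ss (m<n⇒m<1+n j<)) a≤x (<⇒≤ (≰⇒> nle))
    ... | inj₁ refl = contradiction ≤-refl nle
    ... | inj₂ (j , j<m , p) = inj₂ (j , m<n⇒m<1+n j<m , p)

    first : ∀ {m} → Steps m → ∀ i → w i ≡ a → i ≤ m → i ≡ 0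
    first ss zero _ _ = refl
    first ss (suc i) e i≤m = contradiction (sym e) (<⇒≢ (increasing {i = 0} ss (s≤s z≤n) i≤m))

    last : ∀ {m j} → Steps m → w m ≡ b → w j ≡ b → j ≤ m → j ≡ m
    last ss eq e j≤m with m≤n⇒m<n∨m≡n j≤m
    ... | inj₁ j<m = contradiction (trans e (sym eq)) (<⇒≢ (increasing ss j<m ≤-refl))
    ... | inj₂ e′ = e′

    below-b : ∀ {m j} → Steps m → w m ≡ b → j ≤ m → w j ≤ b
    below-b ss eq j≤m with m≤n⇒m<n∨m≡n j≤m
    ... | inj₁ j<m = ≤-trans (<⇒≤ (increasing ss j<m ≤-refl)) (≤-reflexive eq)
    ... | inj₂ refl = ≤-reflexive eq

    -- A chord from `w i` would be a longer step than the one taken. The only edge that the walk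
    -- refuses is `ab`, and that one joins its two ends.
    unchorded : ∀ {m} → Steps m → w m ≡ b →
      ¬ (∃[ i ] ∃[ j ] suc i < j × j ≤ m × ¬ (i ≡ 0 × j ≡ m) × w i ~ w j)
    unchorded ss eq (i , j , si<j , j≤m , ¬ends , adj)
      with wi≡a , wj≡b ← not-ahead
        (proj₂ (proj₂ (proj₂ (ss {i} (≤-trans (<⇒≤ si<j) j≤m)))) (increasing ss si<j j≤m) (s≤s (below-b ss eq j≤m))) adj
      = ¬ends (first ss i wi≡a (≤-trans (<⇒≤ (<-trans ≤-refl si<j)) j≤m) , last ss eq wj≡b j≤m)

    -- The greedy walk that always takes the longest edge has no chords, so if it arrives at b,
    -- chordality makes it a path a – t – b.
    arrives⇒apex : ∀ m → Steps m → w m ≡ b → Apex a b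
    arrives⇒apex 0 ss eq = contradiction eq (<⇒≢ a<b)
    arrives⇒apex 1 ss eq = contradiction (refl , eq) (proj₂ (proj₁ (proj₂ (proj₂ (ss {0} ≤-refl)))))
    arrives⇒apex 2 ss eq with s₀ ← ss {0} (s≤s z≤n) | s₁ ← ss {1} ≤-refl =
      w 1 , proj₁ s₀ , subst (w 1 <_) eq (proj₁ s₁) , proj₁ (proj₁ (proj₂ (proj₂ s₀))) ,
      subst (w 1 ~_) eq (proj₁ (proj₁ (proj₂ (proj₂ s₁))))
    arrives⇒apex m@(suc (suc (suc _))) ss eq = ⊥-elim (unchorded ss eq
      (chord w m (s≤s (s≤s (s≤s z≤n))) (λ {i} i<m → proj₁ (ss {i} i<m))
        (λ {i} i<m → proj₁ (proj₁ (proj₂ (proj₂ (ss {i} i<m))))) (subst (a ~_) (sym eq) a~b)))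

    -- The cut goes just after the last stop, where `gap` provides an isolated number. An edge other
    -- than `ab` across it would be a longer step if it began at a stop, and would cross a step if
    -- it began strictly inside one.
    stuck⇒cut : ∀ m → Steps m → w m < b → Stuck (w m) → Cut a b
    stuck⇒cut m ss lt stuck = suc (w m) , s≤s (start m ss) , ≤∧≢⇒< lt (λ eq → gap′ m ss _ (~-sym (subst (a ~_) (sym eq) a~b))) , gap′ m ss , cross
      where
      start : ∀ m → Steps m → a ≤ w m
      start zero ss = ≤-refl
      start (suc m) ss = <⇒≤ (increasing {i = 0} ss (s≤s z≤n) ≤-refl)
      gap′ : ∀ m → Steps m → ∀ z → ¬ suc (w m) ~ z
      gap′ zero ss = gap a~b
      gap′ (suc m) ss = gap (~-sym (proj₁ (proj₁ (proj₂ (proj₂ (ss {m} ≤-refl))))))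
      upto : ∀ {j} → j < m → w (suc j) ≤ w m
      upto j<m with m≤n⇒m<n∨m≡n j<m
      ... | inj₁ l = <⇒≤ (increasing ss l ≤-refl)
      ... | inj₂ refl = ≤-refl
      cross : OnlyCross a b (suc (w m))
      cross a≤x x<t t<y y≤b adj with locate m ss a≤x (≤-pred x<t)
      ... | inj₁ refl = not-ahead (stuck (<-trans ≤-refl t<y) (s≤s y≤b)) adj
      ... | inj₂ (j , j<m , wj≤x , x<w) with ss {j} j<m | m≤n⇒m<n∨m≡n wj≤x
      ... | s | inj₂ refl = not-ahead (proj₂ (proj₂ (proj₂ s)) (<-trans (s≤s (upto j<m)) t<y) (s≤s y≤b)) adj
      ... | s | inj₁ wj<x = contradiction adj (noncross wj<x x<w (<-trans (s≤s (upto j<m)) t<y) (proj₁ (proj₁ (proj₂ (proj₂ s)))))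

    apex-or-cut : Apex a b ⊎ Cut a b
    apex-or-cut with run b 0 (<⇒≤ a<b) (m≤m+n b a) (λ ())
    ... | m , ss , inj₁ eq = inj₁ (arrives⇒apex m ss eq)
    ... | m , ss , inj₂ (lt , st) = inj₂ (stuck⇒cut m ss lt st)

-- Colouring intervals

module Extension (G : Layout) (k : ℕ) where
  open Layout G
  open Palette k

  -- Distance two is tested only through middle vertices in the interval. `inP` and `inQ` announce
  -- the colours of the inner neighbours of the ends, so that paths leaving through an end can be
  -- handled when intervals are joined.
  record Sol (a b : ℕ) (ca cb : C) (P Q : List C) : Set where
    constructor sol
    field
      col  : ℕ → C
      atl  : col a ≡ ca
      atr  : col b ≡ cb
      inP  : ∀ {x} → a < x → x < b → a ~ x → col x ∈ P
      inQ  : ∀ {x} → a < x → x < b → b ~ x → col x ∈ Q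
      adj₁ : ∀ {x y} → a ≤ x → x < y → y ≤ b → x ~ y → col x ≢ col y
      adj₂ : ∀ {x y z} → a ≤ x → x < y → y ≤ b → a ≤ z → z ≤ b → z ~ x → z ~ y → col x ≢ col y

  -- By `cross`, only `ab` can pass over `t`. A new conflict therefore runs through `t`, where
  -- `L # M` and the exclusions of `ca` and `cb` apply, or uses the edge `ab`, where `sep` applies.
  module Glue {a t b ca τ cb P₁ L M Q₁ P Q} (a<t : a < t) (t<b : t < b) (cross : OnlyCross a b t)
    (s₁ : Sol a t ca τ P₁ L) (s₂ : Sol t b τ cb M Q₁)
    (P₁⊆P : P₁ ⊆ P) (Q₁⊆Q : Q₁ ⊆ Q) (τ∈P : a ~ t → τ ∈ P) (τ∈Q : b ~ t → τ ∈ Q)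
    (ca∉M : t ~ a → ca ∉ M) (cb∉L : t ~ b → cb ∉ L) (L#M : L # M) (ends : t ~ a → t ~ b → ca ≢ cb)
    (sep : a ~ b → ca ≢ cb × cb ∉ P × ca ∉ Q) where

    private
      module S₁ = Sol s₁
      module S₂ = Sol s₂

    col : ℕ → C
    col i with i ≤? t
    ... | yes _ = S₁.col i
    ... | no _ = S₂.col i

    col-left : ∀ {i} → i ≤ t → col i ≡ S₁.col i
    col-left {i} i≤t with i ≤? t
    ... | yes _ = refl
    ... | no n = contradiction i≤t n

    col-right : ∀ {i} → t ≤ i → col i ≡ S₂.col i
    col-right {i} t≤i with i ≤? t
    ... | no _ = refl
    ... | yes i≤t with refl ← ≤-antisym i≤t t≤i = trans S₁.atr (sym S₂.atl)

    atl : col a ≡ ca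
    atl = trans (col-left (<⇒≤ a<t)) S₁.atl

    atr : col b ≡ cb
    atr = trans (col-right (<⇒≤ t<b)) S₂.atr

    att : col t ≡ τ
    att = trans (col-left ≤-refl) S₁.atr

    inP : ∀ {x} → a < x → x < b → a ~ x → col x ∈ P
    inP {x} a<x x<b adj with <-cmp x t
    ... | tri< x<t _ _ = subst (_∈ P) (sym (col-left (<⇒≤ x<t))) (P₁⊆P (S₁.inP a<x x<t adj))
    ... | tri≈ _ refl _ = subst (_∈ P) (sym att) (τ∈P adj)
    ... | tri> _ _ t<x = contradiction (proj₂ (cross ≤-refl a<t t<x (<⇒≤ x<b) adj)) (<⇒≢ x<b)

    inQ : ∀ {x} → a < x → x < b → b ~ x → col x ∈ Q
    inQ {x} a<x x<b adj with <-cmp x t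
    ... | tri> _ _ t<x = subst (_∈ Q) (sym (col-right (<⇒≤ t<x))) (Q₁⊆Q (S₂.inQ t<x x<b adj))
    ... | tri≈ _ refl _ = subst (_∈ Q) (sym att) (τ∈Q adj)
    ... | tri< x<t _ _ = contradiction (sym (proj₁ (cross (<⇒≤ a<x) x<t t<b ≤-refl (~-sym adj)))) (<⇒≢ a<x)

    cb∉P : a ~ b → cb ∉ P
    cb∉P e = proj₁ (proj₂ (sep e))

    ca∉Q : a ~ b → ca ∉ Q
    ca∉Q e = proj₂ (proj₂ (sep e))

    adj₁ : ∀ {x y} → a ≤ x → x < y → y ≤ b → x ~ y → col x ≢ col y
    adj₁ {x} {y} a≤x x<y y≤b adj eq with ≤-<-connex y t | ≤-<-connex t x
    ... | inj₁ y≤t | _ = S₁.adj₁ a≤x x<y y≤t adj (trans (sym (col-left (<⇒≤ (<-≤-trans x<y y≤t)))) (trans eq (col-left y≤t)))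
    ... | inj₂ _ | inj₁ t≤x = S₂.adj₁ t≤x x<y y≤b adj (trans (sym (col-right t≤x)) (trans eq (col-right (≤-trans t≤x (<⇒≤ x<y)))))
    ... | inj₂ t<y | inj₂ x<t with refl , refl ← cross a≤x x<t t<y y≤b adj =
      proj₁ (sep adj) (trans (sym atl) (trans eq atr))

    nbrL : ∀ {x} → a < x → x < t → t ~ x → col x ∈ L
    nbrL a<x x<t adj = subst (_∈ L) (sym (col-left (<⇒≤ x<t))) (S₁.inQ a<x x<t adj)

    nbrM : ∀ {x} → t < x → x < b → t ~ x → col x ∈ M
    nbrM t<x x<b adj = subst (_∈ M) (sym (col-right (<⇒≤ t<x))) (S₂.inP t<x x<b adj)

    around-t : ∀ {x y} → a ≤ x → x < t → t < y → y ≤ b → t ~ x → t ~ y → col x ≢ col y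
    around-t a≤x x<t t<y y≤b tx ty eq with m≤n⇒m<n∨m≡n a≤x | m≤n⇒m<n∨m≡n y≤b
    ... | inj₁ a<x | inj₁ y<b = L#M (nbrL a<x x<t tx) (subst (_∈ M) (sym eq) (nbrM t<y y<b ty))
    ... | inj₁ a<x | inj₂ refl = cb∉L ty (subst (_∈ L) (trans eq atr) (nbrL a<x x<t tx))
    ... | inj₂ refl | inj₁ y<b = ca∉M tx (subst (_∈ M) (trans (sym eq) atl) (nbrM t<y y<b ty))
    ... | inj₂ refl | inj₂ refl = ends tx ty (trans (sym atl) (trans eq atr))

    left-pair : ∀ {x y z} → a ≤ x → x < y → y ≤ t → a ≤ z → z ≤ t → z ~ x → z ~ y → col x ≢ col y
    left-pair a≤x x<y y≤t a≤z z≤t zx zy eq = S₁.adj₂ a≤x x<y y≤t a≤z z≤t zx zy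
      (trans (sym (col-left (<⇒≤ (<-≤-trans x<y y≤t)))) (trans eq (col-left y≤t)))

    right-pair : ∀ {x y z} → t ≤ x → x < y → y ≤ b → t ≤ z → z ≤ b → z ~ x → z ~ y → col x ≢ col y
    right-pair t≤x x<y y≤b t≤z z≤b zx zy eq = S₂.adj₂ t≤x x<y y≤b t≤z z≤b zx zy
      (trans (sym (col-right t≤x)) (trans eq (col-right (≤-trans t≤x (<⇒≤ x<y)))))

    adj₂ : ∀ {x y z} → a ≤ x → x < y → y ≤ b → a ≤ z → z ≤ b → z ~ x → z ~ y → col x ≢ col y
    adj₂ {x} {y} {z} a≤x x<y y≤b a≤z z≤b zx zy with <-cmp z t
    adj₂ {x} {y} {z} a≤x x<y y≤b a≤z z≤b zx zy | tri≈ _ refl _ with ≤-<-connex y t | ≤-<-connex t x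
    ... | inj₁ y≤t | _ = left-pair a≤x x<y y≤t a≤z ≤-refl zx zy
    ... | inj₂ _ | inj₁ t≤x = right-pair t≤x x<y y≤b ≤-refl z≤b zx zy
    ... | inj₂ t<y | inj₂ x<t = around-t a≤x x<t t<y y≤b zx zy
    adj₂ {x} {y} {z} a≤x x<y y≤b a≤z z≤b zx zy | tri< z<t _ _ with ≤-<-connex y t
    ... | inj₁ y≤t = left-pair a≤x x<y y≤t a≤z (<⇒≤ z<t) zx zy
    ... | inj₂ t<y with refl , refl ← cross a≤z z<t t<y y≤b zy =
      λ eq → cb∉P zy (subst (_∈ P) (trans eq atr) (inP (≤∧≢⇒< a≤x λ { refl → ~-irrefl zx }) x<y zx))
    adj₂ {x} {y} {z} a≤x x<y y≤b a≤z z≤b zx zy | tri> _ _ t<z with ≤-<-connex t x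
    ... | inj₁ t≤x = right-pair t≤x x<y y≤b (<⇒≤ t<z) z≤b zx zy
    ... | inj₂ x<t with refl , refl ← cross a≤x x<t t<z z≤b (~-sym zx) =
      λ eq → ca∉Q (~-sym zx) (subst (_∈ Q) (trans (sym eq) atl) (inQ x<y (≤∧≢⇒< y≤b λ { refl → ~-irrefl zy }) zy))

    glue : Sol a b ca cb P Q
    glue = sol col atl atr inP inQ adj₁ adj₂

  trivial-sol : ∀ {a ca cb P Q} → (a ~ suc a → ca ≢ cb) → Sol a (suc a) ca cb P Q
  trivial-sol {a} {ca} {cb} sep = sol col atl atr (λ a<x x≤a _ → contradiction (≤-pred x≤a) (<⇒≱ a<x))
    (λ a<x x≤a _ → contradiction (≤-pred x≤a) (<⇒≱ a<x)) adj₁ adj₂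
    where
    col : ℕ → C
    col i with i ≟ a
    ... | yes _ = ca
    ... | no _ = cb
    atl : col a ≡ ca
    atl with a ≟ a
    ... | yes _ = refl
    ... | no n = contradiction refl n
    atr : col (suc a) ≡ cb
    atr with suc a ≟ a
    ... | yes eq = contradiction eq λ ()
    ... | no n = refl
    ends : ∀ {x y} → a ≤ x → x < y → y ≤ suc a → x ≡ a × y ≡ suc a
    ends a≤x x<y y≤ = ≤-antisym (≤-pred (≤-trans x<y y≤)) a≤x , ≤-antisym y≤ (≤-trans (s≤s a≤x) x<y)
    adj₁ : ∀ {x y} → a ≤ x → x < y → y ≤ suc a → x ~ y → col x ≢ col y
    adj₁ a≤x x<y y≤ adj eq with refl , refl ← ends a≤x x<y y≤ = sep adj (trans (sym atl) (trans eq atr))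
    adj₂ : ∀ {x y z} → a ≤ x → x < y → y ≤ suc a → a ≤ z → z ≤ suc a → z ~ x → z ~ y → col x ≢ col y
    adj₂ {z = z} a≤x x<y y≤ a≤z z≤ zx zy with refl , refl ← ends a≤x x<y y≤ with m≤n⇒m<n∨m≡n a≤z
    ... | inj₂ refl = contradiction zx ~-irrefl
    ... | inj₁ a<z with refl ← ≤-antisym z≤ a<z = contradiction zy ~-irrefl

-- The recursion over intervals

module Colouring (G : Layout) (k : ℕ)
  (deg : ∀ x n → Layout.nbrs G x n < k)
  (no-F₄ : k ≤ 5 → ∀ {a t b} → a < t → t < b → Layout._~_ G a b → Layout._~_ G a t → Layout._~_ G t b →
    Layout.Outer G a b → Layout.Apex G a t → Layout.Apex G t b → ⊥) where
  open Layout G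
  open Palette k
  open Extension G k

  -- With at most five colours Apart may fail, but then the degree bound or the absence of F₄
  -- forbids triangles on both remaining sides of the triangle on ab.
  Exempt : ℕ → ℕ → Set
  Exempt a b = k ≤ 4 ⊎ (k ≤ 5 × Outer a b)

  -- In a leftward piece b is not adjacent to the interior, in a rightward piece a is not.
  data Kind (a b : ℕ) (P Q : List C) : Set where
    apexed    : a ~ b → Apex a b → Inv (Exempt a b) P Q → Kind a b P Q
    flat      : a ~ b → ¬ Apex a b → Kind a b P Q
    leftward  : (∀ {x} → a < x → x < b → ¬ b ~ x) → Kind a b P Q
    rightward : (∀ {x} → a < x → x < b → ¬ a ~ x) → Kind a b P Q

  -- `lenP` and `lenQ` match the lists with the numbers of neighbours of `a` and `b` strictly
  -- between them, in additive form to avoid truncated subtraction.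
  record Piece (a b : ℕ) (ca cb : C) (P Q : List C) : Set where
    constructor piece
    field
      a<b  : a < b
      uP   : Unique P
      uQ   : Unique Q
      ca∉P : ca ∉ P
      cb∉Q : cb ∉ Q
      sep  : a ~ b → ca ≢ cb × cb ∉ P × ca ∉ Q
      lenP : nbrs a (suc a) + length P ≡ nbrs a b
      lenQ : nbrs b (suc a) + length Q ≡ nbrs b b
      kind : Kind a b P Q

  inner : ℕ → ℕ → ℕ → ℕ
  inner x m n = nbrs x n ∸ nbrs x m

  inner-eq : ∀ x {m n} → m ≤ n → nbrs x m + inner x m n ≡ nbrs x n
  inner-eq x m≤n = m+[n∸m]≡n (nbrs-mono x m≤n)

  inner-pos : ∀ {x m n i} → m ≤ i → i < n → x ~ i → 0 < inner x m n
  inner-pos m≤i i<n adj = m<n⇒0<n∸m (nbrs-some m≤i i<n adj)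

  inner-split : ∀ {a t b} → a < t → t < b →
    nbrs t (suc a) + (inner t (suc a) t + inner t (suc t) b) ≡ nbrs t b
  inner-split {a} {t} {b} a<t t<b =
    trans (sym (+-assoc (nbrs t (suc a)) _ _))
      (trans (cong (_+ inner t (suc t) b) (trans (inner-eq t a<t) (sym (nbrs-nonadj ~-irrefl)))) (inner-eq t t<b))

  no-inner : ∀ {x a b} → a < b → (∀ {i} → a < i → i < b → ¬ x ~ i) → nbrs x (suc a) + 0 ≡ nbrs x b
  no-inner {x} a<b none = trans (+-identityʳ _) (sym (nbrs-none x a<b none))

  pos-length : ∀ {m n l} → m + l ≡ n → m < n → 0 < l
  pos-length {m} {l = zero} refl lt = contradiction (sym (+-identityʳ m)) (<⇒≢ lt)
  pos-length {l = suc l} _ _ = s≤s z≤n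

  edge-kind : ∀ {a b P Q} → a ~ b → Dec (Apex a b) → (Apex a b → Inv (Exempt a b) P Q) → Kind a b P Q
  edge-kind adj (yes ap) i = apexed adj ap (i ap)
  edge-kind adj (no ¬ap) i = flat adj ¬ap

  Solver : ℕ → Set
  Solver fuel = ∀ {a b ca cb P Q} → b ≤ fuel + a → Piece a b ca cb P Q → Sol a b ca cb P Q

  left-fuel : ∀ fuel {a t b} → b ≤ suc fuel + a → t < b → t ≤ fuel + a
  left-fuel fuel enough t<b = ≤-pred (≤-trans t<b enough)

  right-fuel : ∀ {fuel a t b} → b ≤ suc fuel + a → a < t → b ≤ fuel + t
  right-fuel {fuel} {a} enough a<t =
    ≤-trans enough (≤-trans (≤-reflexive (sym (+-suc fuel a))) (+-monoʳ-≤ fuel a<t))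

  module Apexed {fuel a t b ca cb τ R S} (solve : Solver fuel) (enough : b ≤ suc fuel + a)
    (pc : Piece a b ca cb (τ ∷ R) (τ ∷ S)) (a~b : a ~ b) (a<t : a < t) (t<b : t < b) (a~t : a ~ t) (t~b : t ~ b)
    (apart : Exempt a b ⊎ Apart R S) (tight : Tight R S) where

    open Piece pc

    X : List C
    X = ca ∷ cb ∷ τ ∷ []

    p q : ℕ
    p = inner t (suc a) t
    q = inner t (suc t) b

    ca≢τ : ca ≢ τ
    ca≢τ eq = ca∉P (here eq)

    cb≢τ : cb ≢ τ
    cb≢τ eq = cb∉Q (here eq)

    cross : OnlyCross a b t
    cross {x} {y} a≤x x<t t<y y≤b adj with m≤n⇒m<n∨m≡n a≤x | m≤n⇒m<n∨m≡n y≤b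
    ... | inj₁ a<x | _ = contradiction adj (noncross a<x x<t t<y a~t)
    ... | inj₂ refl | inj₁ y<b = contradiction t~b (noncross a<t t<y y<b adj)
    ... | inj₂ refl | inj₂ refl = refl , refl

    -- By `cross`, `t` is the last inner neighbour of `a`, so dropping its colour `τ` corresponds to
    -- counting only up to `t`.
    lenR : nbrs a (suc a) + length R ≡ nbrs a t
    lenR = suc-injective (trans (sym (+-suc _ _)) (trans lenP (trans
      (nbrs-none a t<b λ t<i i<b adj → contradiction (proj₂ (cross ≤-refl a<t t<i (<⇒≤ i<b) adj)) (<⇒≢ i<b))
      (nbrs-adj a~t))))

    lenS : nbrs b (suc t) + length S ≡ nbrs b b
    lenS = trans (cong (_+ length S) (trans (nbrs-adj (~-sym t~b)) (cong suc
        (nbrs-none b a<t λ a<i i<t adj → contradiction (sym (proj₁ (cross (<⇒≤ a<i) i<t t<b ≤-refl (~-sym adj)))) (<⇒≢ a<i)))))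
      (trans (sym (+-suc _ _)) lenQ)

    -- Apart from its `p + q` neighbours in the two gaps, `t` is adjacent to `a` and `b`, and its
    -- degree is below `k`.
    bound : 3 + (p + q) ≤ k
    bound = ≤-trans (s≤s (s≤s (≤-trans
        (+-monoˡ-≤ (p + q) (nbrs-some z≤n ≤-refl (~-sym a~t)))
        (≤-reflexive (inner-split a<t t<b)))))
      (≤-trans (s≤s (≤-reflexive (sym (nbrs-adj t~b)))) (deg t (suc b)))

    posL : Apex a t → 0 < length R × 0 < p
    posL (x , a<x , x<t , a~x , x~t) = pos-length lenR (nbrs-some a<x x<t a~x) , inner-pos a<x x<t (~-sym x~t)

    posR : Apex t b → 0 < length S × 0 < q
    posR (x , t<x , x<b , t~x , x~b) = pos-length lenS (nbrs-some t<x x<b (~-sym x~b)) , inner-pos t<x x<b t~x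

    -- Apexes on both sides make `p` and `q` positive, so `bound` refutes `k ≤ 4`. In the other
    -- exempt case the outer neighbour of `ab` and the two apexes extend the triangle to an F₄.
    far : Exempt a b ⊎ Apart R S → Apex a t → Apex t b → Apart R S
    far (inj₂ ap) l r = ap
    far (inj₁ (inj₁ k≤4)) l r = contradiction
      (≤-trans (≤-trans (+-monoʳ-≤ 3 (+-mono-≤ (proj₂ (posL l)) (proj₂ (posR r)))) bound) k≤4)
      λ { (s≤s (s≤s (s≤s (s≤s ())))) }
    far (inj₁ (inj₂ (k≤5 , outer))) l r = ⊥-elim (no-F₄ k≤5 a<t t<b a~b a~t t~b outer l r)

    uX : Unique X
    uX = unique-∷ (∉-cons (proj₁ (sep a~b)) (∉-cons ca≢τ λ ())) (unique-pair cb≢τ)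

    R#X : R # X
    R#X = #-sym (∷-# (λ s → ca∉P (there s)) (pair-# (λ s → proj₁ (proj₂ (sep a~b)) (there s)) (head∉tail uP)))

    S#X : S # X
    S#X = #-sym (∷-# (λ s → proj₂ (proj₂ (sep a~b)) (there s)) (pair-# (λ s → cb∉Q (there s)) (head∉tail uQ)))

    finish : Choice X R S p q (Apex a t) (Apex t b) (Exempt a t) (Exempt t b) → Sol a b ca cb (τ ∷ R) (τ ∷ S)
    finish (choice {R₁} {S₁} {L} {M} reR reS lenL lenM uL uM L#X M#X L#M invL invR) =
      Glue.glue a<t t<b cross (solve (left-fuel fuel enough t<b) pL) (solve (right-fuel enough a<t) pR)
        (λ s → there (R.sub s)) (λ s → there (S.sub s)) (λ _ → here refl) (λ _ → here refl)
        (λ _ s → M#X s (here refl)) (λ _ s → L#X s (there (here refl))) L#M (λ _ _ → proj₁ (sep a~b)) sep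
      where
      module R = Reorder reR
      module S = Reorder reS
      pL : Piece a t ca τ R₁ L
      pL = piece a<t R.uniq uL (λ s → R#X (R.sub s) (here refl)) (λ s → L#X s (there (there (here refl))))
        (λ _ → ca≢τ , (λ s → R#X (R.sub s) (there (there (here refl)))) , λ s → L#X s (here refl))
        (trans (cong (_ +_) R.size) lenR) (trans (cong (_ +_) lenL) (inner-eq t a<t))
        (edge-kind a~t (apex? a t) invL)
      pR : Piece t b τ cb M S₁
      pR = piece t<b uM S.uniq (λ s → M#X s (there (there (here refl)))) (λ s → S#X (S.sub s) (there (here refl)))
        (λ _ → (λ eq → cb≢τ (sym eq)) , (λ s → M#X s (there (here refl))) , λ s → S#X (S.sub s) (there (there (here refl))))
        (trans (cong (_ +_) lenM) (inner-eq t t<b)) (trans (cong (_ +_) S.size) lenS)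
        (edge-kind t~b (apex? t b) invR)

    result : Sol a b ca cb (τ ∷ R) (τ ∷ S)
    result = finish (choose (apex? a t) (apex? t b)
      -- The third corner of the triangle is an outer neighbour of each new edge: `b` for `at`, `a`
      -- for `tb`.
      (λ k≤5 → inj₂ (k≤5 , b , inj₂ t<b , a~b , t~b)) (λ k≤5 → inj₂ (k≤5 , a , inj₁ a<t , ~-sym a~t , ~-sym a~b))
      refl uX (unique-tail uP) (unique-tail uQ) R#X S#X bound posL posR (far apart) tight)

  module Flat {fuel a b ca cb P Q} (solve : Solver fuel) (enough : b ≤ suc fuel + a) (pc : Piece a b ca cb P Q) where
    open Piece pc

    cut : Cut a b → Sol a b ca cb P Q
    cut (t , a<t , t<b , isolated , cross) =
      Glue.glue a<t t<b cross (solve (left-fuel fuel enough t<b) pL) (solve (right-fuel enough a<t) pR)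
        (λ s → s) (λ s → s) (λ adj → contradiction (~-sym adj) (isolated a)) (λ adj → contradiction (~-sym adj) (isolated b))
        (λ _ ()) (λ _ ()) (λ ()) (λ adj → contradiction adj (isolated a)) sep
      where
      -- The cut point is isolated, so its list is empty and its colour arbitrary; `ca` is at hand.
      pL : Piece a t ca ca P []
      pL = piece a<t uP [] ca∉P (λ ()) (λ adj → contradiction (~-sym adj) (isolated a))
        (trans lenP (nbrs-none a (<⇒≤ t<b) far)) (no-inner a<t λ _ _ → isolated _)
        (leftward λ _ _ → isolated _)
        where
        far : ∀ {i} → t ≤ i → i < b → ¬ a ~ i
        far t≤i i<b adj with m≤n⇒m<n∨m≡n t≤i
        ... | inj₂ refl = isolated a (~-sym adj)
        ... | inj₁ t<i = <⇒≢ i<b (proj₂ (cross ≤-refl a<t t<i (<⇒≤ i<b) adj))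
      pR : Piece t b ca cb [] Q
      pR = piece t<b [] uQ (λ ()) cb∉Q (λ adj → contradiction adj (isolated b))
        (no-inner t<b λ _ _ → isolated _)
        (trans (cong (_+ length Q) (nbrs-none b (s≤s (<⇒≤ a<t)) near)) lenQ)
        (rightward λ _ _ → isolated _)
        where
        near : ∀ {i} → a < i → i < suc t → ¬ b ~ i
        near a<i i≤t adj with m≤n⇒m<n∨m≡n (≤-pred i≤t)
        ... | inj₂ refl = isolated b (~-sym adj)
        ... | inj₁ i<t = <⇒≢ a<i (sym (proj₁ (cross (<⇒≤ a<i) i<t t<b ≤-refl (~-sym adj))))

    -- Inside the interval `a` can be adjacent only to `b`, which is not adjacent to an inner
    -- `suc a`. Hence `suc a` may repeat the colour `ca`, and a shorter leftward piece remains.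
    detached : (∀ {x} → a < x → x < b → ¬ a ~ x) → (∀ {x} → a < x → x < b → ¬ b ~ x) → Sol a b ca cb P Q
    detached noneA noneB with m≤n⇒m<n∨m≡n a<b
    ... | inj₂ refl = trivial-sol λ adj → proj₁ (sep adj)
    ... | inj₁ sa<b = finish (pick q [ ca ] (≤-trans (≤-reflexive (+-comm q 1)) (≤-trans (s≤s (m∸n≤m _ (nbrs t (suc t)))) (deg t b))))
      where
      t q : ℕ
      t = suc a
      q = inner t (suc t) b
      cross : OnlyCross a b t
      cross a≤x x≤a t<y y≤b adj with refl ← ≤-antisym (≤-pred x≤a) a≤x with m≤n⇒m<n∨m≡n y≤b
      ... | inj₁ y<b = contradiction adj (noneA (<-trans ≤-refl t<y) y<b)
      ... | inj₂ refl = refl , refl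
      finish : ∃[ M ] length M ≡ q × Unique M × M # [ ca ] → Sol a b ca cb P Q
      finish (M , lenM , uM , M#) =
        Glue.glue ≤-refl sa<b cross (trivial-sol {cb = ca} {P = []} {Q = []} λ adj → contradiction adj (noneA ≤-refl sa<b))
          (solve (right-fuel enough ≤-refl) pR) (λ ()) (λ ()) (λ adj → contradiction adj (noneA ≤-refl sa<b))
          (λ adj → contradiction adj (noneB ≤-refl sa<b)) (λ _ s → M# s (here refl)) (λ _ ()) (λ ())
          (λ adj → contradiction (~-sym adj) (noneA ≤-refl sa<b)) sep
        where
        pR : Piece t b ca cb M []
        pR = piece sa<b uM [] (λ s → M# s (here refl)) (λ ()) (λ adj → contradiction (~-sym adj) (noneB ≤-refl sa<b))
          (trans (cong (_ +_) lenM) (inner-eq t sa<b))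
          (no-inner sa<b λ t<i → noneB (<-trans ≤-refl t<i)) (leftward λ t<i → noneB (<-trans ≤-refl t<i))

  -- The last inner neighbour `x` of `a` splits the piece: the edge `ax` starts with an invariant of
  -- its own, and beyond `x` the piece is leftward again.
  module Leftward {fuel a x b ca cb τ R Q} (solve : Solver fuel) (enough : b ≤ suc fuel + a)
    (pc : Piece a b ca cb (τ ∷ R) Q) (none : ∀ {x} → a < x → x < b → ¬ b ~ x)
    (a<x : a < x) (x<b : x < b) (a~x : a ~ x) (max : ∀ {j} → x < j → j < b → ¬ a ~ j) where
    open Piece pc

    X : List C
    X = ca ∷ τ ∷ []

    p q : ℕ
    p = inner x (suc a) x
    q = inner x (suc x) b

    cross : OnlyCross a b x
    cross a≤z z<x x<y y≤b adj with m≤n⇒m<n∨m≡n a≤z | m≤n⇒m<n∨m≡n y≤b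
    ... | inj₁ a<z | _ = contradiction adj (noncross a<z z<x x<y a~x)
    ... | inj₂ refl | inj₁ y<b = contradiction adj (max x<y y<b)
    ... | inj₂ refl | inj₂ refl = refl , refl

    ca≢τ : ca ≢ τ
    ca≢τ eq = ca∉P (here eq)

    lenR : nbrs a (suc a) + length R ≡ nbrs a x
    lenR = suc-injective (trans (sym (+-suc _ _)) (trans lenP (trans (nbrs-none a x<b max) (nbrs-adj a~x))))

    bound : 2 + (p + q) ≤ k
    bound = ≤-trans (s≤s (≤-trans (+-monoˡ-≤ (p + q) (nbrs-some z≤n ≤-refl (~-sym a~x)))
      (≤-reflexive (inner-split a<x x<b)))) (deg x b)

    pos : Apex a x → 0 < length R × 0 < p
    pos (y , a<y , y<x , a~y , y~x) = pos-length lenR (nbrs-some a<y y<x a~y) , inner-pos a<y y<x (~-sym y~x)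

    R#X : R # X
    R#X = #-sym (pair-# (λ s → ca∉P (there s)) (head∉tail uP))

    finish : Choice X R [] p q (Apex a x) ⊥ (Exempt a x) ⊥ → Sol a b ca cb (τ ∷ R) Q
    finish (choice {R₁} {_} {L} {M} reR _ lenL lenM uL uM L#X M#X L#M invL _) =
      Glue.glue a<x x<b cross (solve (left-fuel fuel enough x<b) pL) (solve (right-fuel enough a<x) pR)
        (λ s → there (R.sub s)) (λ ()) (λ _ → here refl) (λ adj → contradiction adj (none a<x x<b))
        (λ _ s → M#X s (here refl)) (λ adj → contradiction (~-sym adj) (none a<x x<b)) L#M
        (λ _ adj → contradiction (~-sym adj) (none a<x x<b)) sep
      where
      module R = Reorder reR
      pL : Piece a x ca τ R₁ L
      pL = piece a<x R.uniq uL (λ s → R#X (R.sub s) (here refl)) (λ s → L#X s (there (here refl)))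
        (λ _ → ca≢τ , (λ s → R#X (R.sub s) (there (here refl))) , λ s → L#X s (here refl))
        (trans (cong (_ +_) R.size) lenR) (trans (cong (_ +_) lenL) (inner-eq x a<x))
        (edge-kind a~x (apex? a x) invL)
      pR : Piece x b τ cb M []
      pR = piece x<b uM [] (λ s → M#X s (there (here refl))) (λ ()) (λ adj → contradiction (~-sym adj) (none a<x x<b))
        (trans (cong (_ +_) lenM) (inner-eq x x<b)) (no-inner x<b λ x<i → none (<-trans a<x x<i))
        (leftward λ x<i → none (<-trans a<x x<i))

    result : Sol a b ca cb (τ ∷ R) Q
    -- No outer neighbour of `ax` is available for the exemption at `k = 5`, but with only two
    -- colours in `X` five colours leave room for a separator.
    result = finish (choose-root (apex? a x) inj₁ refl (unique-tail uP) R#X bound pos)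

  -- The mirror image, splitting at the first inner neighbour of `b`. The roles of `p` and `q` are
  -- exchanged since `choose-root` lists the side with the invariant first.
  module Rightward {fuel a x b ca cb τ S P} (solve : Solver fuel) (enough : b ≤ suc fuel + a)
    (pc : Piece a b ca cb P (τ ∷ S)) (none : ∀ {x} → a < x → x < b → ¬ a ~ x)
    (a<x : a < x) (x<b : x < b) (b~x : b ~ x) (min : ∀ {j} → a < j → j < x → ¬ b ~ j) where
    open Piece pc

    X : List C
    X = cb ∷ τ ∷ []

    p q : ℕ
    p = inner x (suc x) b
    q = inner x (suc a) x

    cross : OnlyCross a b x
    cross a≤z z<x x<y y≤b adj with m≤n⇒m<n∨m≡n a≤z | m≤n⇒m<n∨m≡n y≤b
    ... | inj₁ a<z | inj₁ y<b = contradiction (~-sym b~x) (noncross z<x x<y y<b adj)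
    ... | inj₁ a<z | inj₂ refl = contradiction (~-sym adj) (min a<z z<x)
    ... | inj₂ refl | inj₁ y<b = contradiction adj (none (<-trans a<x x<y) y<b)
    ... | inj₂ refl | inj₂ refl = refl , refl

    cb≢τ : cb ≢ τ
    cb≢τ eq = cb∉Q (here eq)

    lenS : nbrs b (suc x) + length S ≡ nbrs b b
    lenS = trans (cong (_+ length S) (trans (nbrs-adj b~x) (cong suc (nbrs-none b a<x min)))) (trans (sym (+-suc _ _)) lenQ)

    bound : 2 + (p + q) ≤ k
    bound = ≤-trans (s≤s (≤-trans (s≤s (≤-trans (m≤n+m (p + q) (nbrs x (suc a))) (≤-reflexive
      (trans (cong (nbrs x (suc a) +_) (+-comm p q)) (inner-split a<x x<b)))))
      (≤-reflexive (sym (nbrs-adj (~-sym b~x)))))) (deg x (suc b))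

    pos : Apex x b → 0 < length S × 0 < p
    pos (y , x<y , y<b , x~y , y~b) = pos-length lenS (nbrs-some x<y y<b (~-sym y~b)) , inner-pos x<y y<b x~y

    S#X : S # X
    S#X = #-sym (pair-# (λ s → cb∉Q (there s)) (head∉tail uQ))

    finish : Choice X S [] p q (Apex x b) ⊥ (Exempt x b) ⊥ → Sol a b ca cb P (τ ∷ S)
    finish (choice {S₁} {_} {L} {M} reS _ lenL lenM uL uM L#X M#X L#M invL _) =
      Glue.glue a<x x<b cross (solve (left-fuel fuel enough x<b) pL) (solve (right-fuel enough a<x) pR)
        (λ ()) (λ s → there (S.sub s)) (λ adj → contradiction adj (none a<x x<b)) (λ _ → here refl)
        (λ adj → contradiction (~-sym adj) (none a<x x<b)) (λ _ s → M#X s (here refl)) (#-sym L#M)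
        (λ adj → contradiction (~-sym adj) (none a<x x<b)) sep
      where
      module S = Reorder reS
      pL : Piece a x ca τ [] M
      pL = piece a<x [] uM (λ ()) (λ s → M#X s (there (here refl))) (λ adj → contradiction adj (none a<x x<b))
        (no-inner a<x λ a<i i<x → none a<i (<-trans i<x x<b)) (trans (cong (_ +_) lenM) (inner-eq x a<x))
        (rightward λ a<i i<x → none a<i (<-trans i<x x<b))
      pR : Piece x b τ cb L S₁
      pR = piece x<b uL S.uniq (λ s → L#X s (there (here refl))) (λ s → S#X (S.sub s) (here refl))
        (λ _ → (λ eq → cb≢τ (sym eq)) , (λ s → L#X s (here refl)) , λ s → S#X (S.sub s) (there (here refl)))
        (trans (cong (_ +_) lenL) (inner-eq x x<b)) (trans (cong (_ +_) S.size) lenS)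
        (edge-kind (~-sym b~x) (apex? x b) (λ ap → Inv-sym (invL ap)))

    result : Sol a b ca cb P (τ ∷ S)
    result = finish (choose-root (apex? x b) inj₁ refl (unique-tail uQ) S#X bound pos)

  solve : ∀ fuel → Solver fuel
  solve zero enough pc = contradiction enough (<⇒≱ (Piece.a<b pc))
  solve (suc fuel) enough pc@(piece a<b _ _ _ _ _ _ _ (flat a~b ¬apex)) with Walk.apex-or-cut a<b a~b
  ... | inj₁ ap = contradiction ap ¬apex
  ... | inj₂ c = Flat.cut (solve fuel) enough pc c
  solve (suc fuel) enough pc@(piece _ _ _ _ _ _ _ _ (apexed a~b (t , a<t , t<b , a~t , t~b) (inv _ _ _ refl refl apart tight))) =
    Apexed.result (solve fuel) enough pc a~b a<t t<b a~t t~b apart tight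
  solve (suc fuel) {a} {b} {P = P} enough pc@(piece a<b _ _ _ _ _ lenP _ (leftward none)) with rightmost (a ~?_) a b
  ... | inj₂ noneA = Flat.detached (solve fuel) enough pc noneA none
  ... | inj₁ (x , a<x , x<b , a~x , max) = go P pc lenP
    where
    go : ∀ P → Piece a b _ _ P _ → nbrs a (suc a) + length P ≡ nbrs a b → Sol a b _ _ P _
    go [] pc len = contradiction (pos-length len (nbrs-some a<x x<b a~x)) λ ()
    go (_ ∷ _) pc len = Leftward.result (solve fuel) enough pc none a<x x<b a~x max
  solve (suc fuel) {a} {b} {Q = Q} enough pc@(piece a<b _ _ _ _ _ _ lenQ (rightward none)) with leftmost (b ~?_) a b
  ... | inj₂ noneB = Flat.detached (solve fuel) enough pc none noneB
  ... | inj₁ (x , a<x , x<b , b~x , min) = go Q pc lenQ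
    where
    go : ∀ Q → Piece a b _ _ _ Q → nbrs b (suc a) + length Q ≡ nbrs b b → Sol a b _ _ _ Q
    go [] pc len = contradiction (pos-length len (nbrs-some a<x x<b b~x)) λ ()
    go (_ ∷ _) pc len = Rightward.result (solve fuel) enough pc none a<x x<b b~x min

-- Auxiliary facts on neighbour lists, maxima and Booleans

module _ (L : Layout) where
  open Layout L

  nbrs-list : ∀ x n → ∃[ xs ] length xs ≡ nbrs x n × Unique xs × (∀ {i} → i ∈ xs → x ~ i × i < n)
  nbrs-list x zero = [] , refl , [] , λ ()
  nbrs-list x (suc n) with nbrs-list x n | x ~? n
  ... | xs , len , u , spec | yes adj = n ∷ xs , trans (cong suc len) (sym (nbrs-adj adj))
      , unique-∷ (λ n∈ → <-irrefl refl (proj₂ (spec n∈))) u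
      , λ { (here refl) → adj , ≤-refl ; (there i∈) → proj₁ (spec i∈) , m<n⇒m<1+n (proj₂ (spec i∈)) }
  ... | xs , len , u , spec | no ¬adj = xs , trans len (sym (nbrs-nonadj ¬adj)) , u
      , λ i∈ → proj₁ (spec i∈) , m<n⇒m<1+n (proj₂ (spec i∈))

module _ {A : Set} where

  lookup-injective : ∀ {xs : List A} → Unique xs → Injective _≡_ _≡_ (lookup xs)
  lookup-injective {_ ∷ _} u {zero} {zero} _ = refl
  lookup-injective {_ ∷ xs} u {zero} {suc j} eq = contradiction (subst (_∈ xs) (sym eq) (∈-lookup j)) (head∉tail u)
  lookup-injective {_ ∷ xs} u {suc i} {zero} eq = contradiction (subst (_∈ xs) eq (∈-lookup i)) (head∉tail u)
  lookup-injective {_ ∷ _} u {suc i} {suc j} eq = cong suc (lookup-injective (unique-tail u) eq)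

  any-true⁻ : ∀ (f : A → Bool) xs → any f xs ≡ true → ∃[ x ] f x ≡ true
  any-true⁻ f (x ∷ xs) eq with f x in fx
  ... | true = x , fx
  ... | false = any-true⁻ f xs eq

  any-true⁺ : ∀ (f : A → Bool) {xs x} → x ∈ xs → f x ≡ true → any f xs ≡ true
  any-true⁺ f (here refl) eq rewrite eq = refl
  any-true⁺ f {y ∷ _} (there x∈) eq with f y
  ... | true = refl
  ... | false = any-true⁺ f x∈ eq

  maximum : (A → ℕ) → List A → ℕ
  maximum f xs = foldr _⊔_ 0 (map f xs)

  ≤-maximum : ∀ f {xs x} → x ∈ xs → f x ≤ maximum f xs
  ≤-maximum f {y ∷ xs} (here refl) = m≤m⊔n (f y) _
  ≤-maximum f {y ∷ xs} (there x∈) = ≤-trans (≤-maximum f x∈) (m≤n⊔m (f y) _)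

  maximum-attained : ∀ f x xs → ∃[ y ] f y ≡ maximum f (x ∷ xs)
  maximum-attained f x [] = x , sym (⊔-identityʳ (f x))
  maximum-attained f x (x′ ∷ xs) with ⊔-sel (f x) (maximum f (x′ ∷ xs))
  ... | inj₁ eq = x , sym eq
  ... | inj₂ eq with y , fy ← maximum-attained f x′ xs = y , trans fy (sym eq)

∧-true : ∀ x {y} → x ∧ y ≡ true → x ≡ true × y ≡ true
∧-true true eq = refl , eq

∨-true : ∀ x {y} → x ∨ y ≡ true → x ≡ true ⊎ y ≡ true
∨-true true eq = inj₁ refl
∨-true false eq = inj₂ eq

does-true : ∀ {P : Set} (d : Dec P) → does d ≡ true → P
does-true (yes p) _ = p

strict-bound : ∀ {n} (f : Fin n → ℕ) → ∃[ N ] (∀ i → f i < N)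
strict-bound {zero} f = 0 , λ ()
strict-bound {suc n} f with N , f<N ← strict-bound (λ i → f (suc i)) =
  suc (f zero) ⊔ N , λ { zero → m≤m⊔n _ N ; (suc i) → ≤-trans (f<N i) (m≤n⊔m (suc (f zero)) N) }

-- Squares, cliques and F₄

module _ {n : ℕ} (G : Graph n) where

  edge-sym : ∀ {u v} → Edge G u v → Edge G v u
  edge-sym {u} {v} e = trans (sym (adj-sym G u v)) e

  edge-irrefl : ∀ {u} → ¬ Edge G u u
  edge-irrefl {u} e = contradiction (trans (sym e) (irref G u)) λ ()

  neighbours : Fin n → List (Fin n)
  neighbours v = filter (λ w → adj G v w ≟ᵇ true) (allFin n)

  ∈-neighbours : ∀ {v w} → Edge G v w → w ∈ neighbours v
  ∈-neighbours {v} {w} e = ∈-filter⁺ (λ w → adj G v w ≟ᵇ true) (∈-allFin w) e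

  neighbours-unique : ∀ v → Unique (neighbours v)
  neighbours-unique v = filter⁺ (λ w → adj G v w ≟ᵇ true) (allFin⁺ n)

  Near : Fin n → Fin n → Set
  Near u v = Edge G u v ⊎ (∃[ w ] Edge G u w × Edge G w v)

  square⁻ : ∀ {u v} → square-adj G u v ≡ true → u ≢ v × Near u v
  square⁻ {u} {v} eq with u ≟F v
  ... | no u≢v with ∨-true (adj G u v) eq
  ... | inj₁ e = u≢v , inj₁ e
  ... | inj₂ e with w , p ← any-true⁻ _ (allFin n) e = u≢v , inj₂ (w , ∧-true (adj G u w) p)

  square⁺ : ∀ {u v} → u ≢ v → Near u v → square-adj G u v ≡ true
  square⁺ {u} {v} u≢v near with u ≟F v | adj G u v
  ... | yes eq | _ = contradiction eq u≢v
  ... | no _ | true = refl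
  square⁺ {u} {v} u≢v (inj₁ ()) | no _ | false
  square⁺ {u} {v} u≢v (inj₂ (w , p , q)) | no _ | false = any-true⁺ _ (∈-allFin w) (both p q)
    where
    both : ∀ {x y} → x ≡ true → y ≡ true → x ∧ y ≡ true
    both refl refl = refl

module _ {n : ℕ} {H : Fin n → Fin n → Bool} where

  clique≤colours : ∀ {k m} {f : Fin m → Fin n} {c : Fin n → Fin k} → IsClique H m f → IsProperColouring H k c → m ≤ k
  clique≤colours {f = f} {c} (f-inj , clique) proper = injective⇒≤ {f = λ i → c (f i)} inj
    where
    inj : Injective _≡_ _≡_ (λ i → c (f i))
    inj {i} {j} eq = decidable-stable (i ≟F j) λ i≢j → proper (f i) (f j) (clique i j i≢j) eq

  -- No clique is larger than the palette of a proper colouring, so a clique and a colouring of the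
  -- same size are both optimal.
  clique+colouring : ∀ {k} → Σ (Fin k → Fin n) (IsClique H k) → Σ (Fin n → Fin k) (IsProperColouring H k) →
    CliqueNumber H k × ChromaticNumber H k
  clique+colouring (f , cl) (c , pr) =
    ((f , cl) , λ m g cl′ → clique≤colours cl′ pr) , ((c , pr) , λ m c′ pr′ → clique≤colours cl pr′)

  list-clique : ∀ {xs} → Unique xs → (∀ {x y} → x ∈ xs → y ∈ xs → x ≢ y → H x y ≡ true) →
    Σ (Fin (length xs) → Fin n) (IsClique H (length xs))
  list-clique {xs} u pairs = lookup xs , lookup-injective u ,
    λ i j i≢j → pairs (∈-lookup i) (∈-lookup j) (λ eq → i≢j (lookup-injective u eq))

nbhd-clique : ∀ {n} (G : Graph n) v → Σ (Fin (suc (degree G v)) → Fin n) (IsClique (square-adj G) (suc (degree G v)))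
nbhd-clique {n} G v = list-clique (unique-∷ v∉ (neighbours-unique G v)) λ p q x≢y → square⁺ G x≢y (near p q x≢y)
  where
  to-edge : ∀ {w} → w ∈ neighbours G v → Edge G v w
  to-edge w∈ = proj₂ (∈-filter⁻ (λ w → adj G v w ≟ᵇ true) {xs = allFin n} w∈)
  v∉ : v ∉ neighbours G v
  v∉ v∈ = edge-irrefl G (to-edge v∈)
  near : ∀ {x y} → x ∈ v ∷ neighbours G v → y ∈ v ∷ neighbours G v → x ≢ y → Near G x y
  near (here refl) (here refl) x≢y = contradiction refl x≢y
  near (here refl) (there q) _ = inj₁ (to-edge q)
  near (there p) (here refl) _ = inj₁ (edge-sym G (to-edge p))
  near (there p) (there q) _ = inj₂ (v , edge-sym G (to-edge p) , to-edge q)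

module F₄ where

  Close : Fin 6 → Fin 6 → Set
  Close x h = x ≡ h ⊎ F4Edge x h ⊎ F4Edge h x

  data TwoOf (x : Fin 6) : Set where
    near01 : Close x (# 0) → Close x (# 1) → TwoOf x
    near12 : Close x (# 1) → Close x (# 2) → TwoOf x
    near02 : Close x (# 0) → Close x (# 2) → TwoOf x

  twoOf : ∀ x → TwoOf x
  twoOf zero = near01 (inj₁ refl) (inj₂ (inj₁ e01))
  twoOf (suc zero) = near01 (inj₂ (inj₂ e01)) (inj₁ refl)
  twoOf (suc (suc zero)) = near12 (inj₂ (inj₂ e12)) (inj₁ refl)
  twoOf (suc (suc (suc zero))) = near01 (inj₂ (inj₁ e30)) (inj₂ (inj₁ e31))
  twoOf (suc (suc (suc (suc zero)))) = near12 (inj₂ (inj₁ e41)) (inj₂ (inj₁ e42))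
  twoOf (suc (suc (suc (suc (suc zero))))) = near02 (inj₂ (inj₁ e50)) (inj₂ (inj₁ e52))

  -- Every vertex is within distance 1 of two corners of the triangle, so any two vertices share one.
  hub : ∀ {x y} → TwoOf x → TwoOf y → ∃[ h ] Close x h × Close y h
  hub (near01 p _) (near01 q _) = _ , p , q
  hub (near01 _ p) (near12 q _) = _ , p , q
  hub (near01 p _) (near02 q _) = _ , p , q
  hub (near12 p _) (near01 _ q) = _ , p , q
  hub (near12 p _) (near12 q _) = _ , p , q
  hub (near12 _ p) (near02 _ q) = _ , p , q
  hub (near02 p _) (near01 q _) = _ , p , q
  hub (near02 _ p) (near12 _ q) = _ , p , q
  hub (near02 p _) (near02 q _) = _ , p , q

  module _ {n : ℕ} {G : Graph n} (f : Fin 6 → Fin n) (f-inj : Injective _≡_ _≡_ f)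
    (edges : ∀ x y → F4Edge x y → Edge G (f x) (f y)) where

    close : ∀ {x h} → Close x h → x ≡ h ⊎ Edge G (f x) (f h)
    close (inj₁ eq) = inj₁ eq
    close (inj₂ (inj₁ e)) = inj₂ (edges _ _ e)
    close (inj₂ (inj₂ e)) = inj₂ (edge-sym G (edges _ _ e))

    near : ∀ i j → i ≢ j → Near G (f i) (f j)
    near i j i≢j with h , p , q ← hub (twoOf i) (twoOf j) with close p | close q
    ... | inj₁ refl | inj₁ refl = contradiction refl i≢j
    ... | inj₁ refl | inj₂ e = inj₁ (edge-sym G e)
    ... | inj₂ e | inj₁ refl = inj₁ e
    ... | inj₂ e | inj₂ e′ = inj₂ (f h , e , edge-sym G e′)

    clique : IsClique (square-adj G) 6 f
    clique = f-inj , λ i j i≢j → square⁺ G (λ eq → i≢j (f-inj eq)) (near i j i≢j)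

    -- A corner of the triangle sees the two other corners and two added vertices. This turns
    -- `Δ ≤ 4` into `Δ ≡ 4` when an F₄ is present.
    degree≥4 : 4 ≤ degree G (f (# 0))
    degree≥4 = ⊆⇒length≤ {ys = neighbours G (f (# 0))} (map⁺ f-inj u) sub
      where
      spokes : List (Fin 6)
      spokes = # 1 ∷ # 2 ∷ # 3 ∷ # 5 ∷ []
      u : Unique spokes
      u = from-yes (unique? _≟F_ spokes)
      sub : map f spokes ⊆ neighbours G (f (# 0))
      sub (here refl) = ∈-neighbours G (edges _ _ e01)
      sub (there (here refl)) = ∈-neighbours G (edges _ _ e02)
      sub (there (there (here refl))) = ∈-neighbours G (edge-sym G (edges _ _ e30))
      sub (there (there (there (here refl)))) = ∈-neighbours G (edge-sym G (edges _ _ e50))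

-- From an outerplanar drawing to a layout and a colouring of the square

module Drawing {n : ℕ} (G : Graph n) (chordal : Chordal G) (p : Fin n → ℕ) (p-inj : Injective _≡_ _≡_ p)
  (planar : ∀ a b c d → Edge G a b → Edge G c d → ¬ (p a < p c × p c < p b × p b < p d)) where

  -- Odd positions only, so that the even numbers serve as the isolated cutting points of a Layout.
  pos : Fin n → ℕ
  pos u = suc (2 * p u)

  pos-inj : Injective _≡_ _≡_ pos
  pos-inj eq = p-inj (*-cancelˡ-≡ _ _ 2 (suc-injective eq))

  pos-cancel-< : ∀ {u v} → pos u < pos v → p u < p v
  pos-cancel-< lt = *-cancelˡ-< 2 _ _ (≤-pred lt)

  Joined : ℕ → ℕ → Set
  Joined i j = ∃[ u ] ∃[ v ] pos u ≡ i × pos v ≡ j × Edge G u v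

  joined? : ∀ i j → Dec (Joined i j)
  joined? i j = anyF? λ u → anyF? λ v → (pos u ≟ i) ×-dec (pos v ≟ j) ×-dec (adj G u v ≟ᵇ true)

  joined : ∀ {i j} → does (joined? i j) ≡ true → Joined i j
  joined = does-true (joined? _ _)

  adjacent : ∀ {u v} → Edge G u v → does (joined? (pos u) (pos v)) ≡ true
  adjacent e = dec-true (joined? _ _) (_ , _ , refl , refl , e)

  edge : ∀ {u v} → does (joined? (pos u) (pos v)) ≡ true → Edge G u v
  edge e with u′ , v′ , eq , eq′ , e′ ← joined e with refl ← pos-inj eq | refl ← pos-inj eq′ = e′

  -- The increasing walk and its closing edge form a cycle on at least four vertices. Its chord is
  -- ordered by index; not being cyclically consecutive excludes both adjacent indices and the pair
  -- of ends.
  cycle-chord : ∀ (w : ℕ → ℕ) m → 3 ≤ m → (∀ {i} → i < m → w i < w (suc i)) →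
    (∀ {i} → i < m → does (joined? (w i) (w (suc i))) ≡ true) → does (joined? (w 0) (w m)) ≡ true →
    ∃[ i ] ∃[ j ] suc i < j × j ≤ m × ¬ (i ≡ 0 × j ≡ m) × does (joined? (w i) (w j)) ≡ true
  cycle-chord w m 3≤m mono path closing = found (chordal (suc m) c (s≤s 3≤m) (c-inj , c-edge))
    where
    at : ∀ i → i ≤ m → ∃[ u ] pos u ≡ w i
    at i i≤m with m≤n⇒m<n∨m≡n i≤m
    ... | inj₁ i<m with u , _ , eq , _ ← joined (path i<m) = u , eq
    ... | inj₂ refl with _ , v , _ , eq , _ ← joined closing = v , eq
    c : Fin (suc m) → Fin n
    c i = proj₁ (at (toℕ i) (≤-pred (toℕ<n i)))
    pos-c : ∀ i → pos (c i) ≡ w (toℕ i)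
    pos-c i = proj₂ (at (toℕ i) (≤-pred (toℕ<n i)))
    increasing : ∀ {i j} → i < j → j ≤ m → w i < w j
    increasing {j = suc j} i<j j≤m with m≤n⇒m<n∨m≡n (≤-pred i<j)
    ... | inj₁ i<j′ = <-trans (increasing i<j′ (≤-trans (n≤1+n j) j≤m)) (mono j≤m)
    ... | inj₂ refl = mono j≤m
    c-inj : Injective _≡_ _≡_ c
    c-inj {i} {j} eq with <-cmp (toℕ i) (toℕ j)
    ... | tri≈ _ e _ = toℕ-injective e
    ... | tri< lt _ _ = contradiction (trans (sym (pos-c i)) (trans (cong pos eq) (pos-c j))) (<⇒≢ (increasing lt (≤-pred (toℕ<n j))))
    ... | tri> _ _ lt = contradiction (trans (sym (pos-c j)) (trans (cong pos (sym eq)) (pos-c i))) (<⇒≢ (increasing lt (≤-pred (toℕ<n i))))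
    to-edge : ∀ {i j} → does (joined? (w (toℕ i)) (w (toℕ j))) ≡ true → Edge G (c i) (c j)
    to-edge {i} {j} e = edge (subst (λ x → does (joined? x (pos (c j))) ≡ true) (sym (pos-c i))
      (subst (λ y → does (joined? (w (toℕ i)) y) ≡ true) (sym (pos-c j)) e))
    from-edge : ∀ {i j} → Edge G (c i) (c j) → does (joined? (w (toℕ i)) (w (toℕ j))) ≡ true
    from-edge {i} {j} e = subst (λ x → does (joined? x (w (toℕ j))) ≡ true) (pos-c i)
      (subst (λ y → does (joined? (pos (c i)) y) ≡ true) (pos-c j) (adjacent e))
    c-edge : ∀ i j → CycSucc (suc m) i j → Edge G (c i) (c j)
    c-edge i j (inj₁ eq) = to-edge (subst (λ y → does (joined? (w (toℕ i)) (w y)) ≡ true) eq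
      (path (subst (_≤ m) (sym eq) (≤-pred (toℕ<n j)))))
    c-edge i j (inj₂ (i≡m , j≡0)) = edge-sym G (to-edge
      (subst (λ x → does (joined? (w x) (w (toℕ i))) ≡ true) (sym j≡0) (subst (λ y → does (joined? (w 0) (w y)) ≡ true) (sym i≡m) closing)))
    Found : Set
    Found = ∃[ i ] ∃[ j ] suc i < j × j ≤ m × ¬ (i ≡ 0 × j ≡ m) × does (joined? (w i) (w j)) ≡ true
    ordered : ∀ i j → toℕ i < toℕ j → ¬ CycSucc (suc m) i j → ¬ CycSucc (suc m) j i → Edge G (c i) (c j) → Found
    ordered i j lt n₁ n₂ e = toℕ i , toℕ j , ≤∧≢⇒< lt (λ eq → n₁ (inj₁ eq)) , ≤-pred (toℕ<n j)
      , (λ (i≡0 , j≡m) → n₂ (inj₂ (j≡m , i≡0))) , from-edge e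
    found : HasChord G (suc m) c → Found
    found (i , j , n₁ , n₂ , e) with <-cmp (toℕ i) (toℕ j)
    ... | tri< lt _ _ = ordered i j lt n₁ n₂ e
    ... | tri> _ _ lt = ordered j i lt n₂ n₁ (edge-sym G e)
    ... | tri≈ _ eq _ with refl ← toℕ-injective eq = contradiction e (edge-irrefl G)

  layout : Layout
  layout = record
    { E = λ i j → does (joined? i j)
    ; ~-sym = λ e → flip-edge (joined e)
    ; ~-irrefl = λ e → loop (joined e)
    ; noncross = λ a<c c<b b<d e e′ → uncrossed a<c c<b b<d (joined e) (joined e′)
    ; gap = λ e z e′ → parity (joined e) (joined e′)
    ; chord = cycle-chord
    }
    where
    flip-edge : ∀ {i j} → Joined i j → does (joined? j i) ≡ true
    flip-edge (u , v , refl , refl , e) = adjacent (edge-sym G e)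
    loop : ∀ {i} → ¬ Joined i i
    loop (u , v , refl , eq , e) with refl ← pos-inj eq = edge-irrefl G e
    uncrossed : ∀ {a b c d} → a < c → c < b → b < d → Joined a b → ¬ Joined c d
    uncrossed l m r (u , v , refl , refl , e) (u′ , v′ , refl , refl , e′) =
      planar u v u′ v′ e e′ (pos-cancel-< l , pos-cancel-< m , pos-cancel-< r)
    parity : ∀ {x y z} → Joined x y → ¬ Joined (suc x) z
    parity (u , _ , refl , _) (u′ , _ , eq , _) =
      even≢odd (suc (p u)) (p u′) (trans (*-suc 2 (p u)) (sym eq))

  open Layout layout

  module _ (k : ℕ) (deg<k : ∀ v → degree G v < k) (k≤5⇒no-F₄ : k ≤ 5 → ¬ ContainsF4 G) where
    open Palette k
    open Extension layout k

    -- A number with a neighbour is the position of a vertex, whose degree bounds the count. If no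
    -- neighbour is listed, `v₀` supplies `0 < k`.
    nbrs<k : ∀ {v₀ : Fin n} x m → nbrs x m < k
    nbrs<k {v₀} x m with nbrs-list layout x m
    ... | [] , len , _ = subst (_< k) len (≤-trans (s≤s z≤n) (deg<k v₀))
    ... | xs@(_ ∷ _) , len , u , spec with v , _ , refl , _ ← joined (proj₁ (spec (here refl))) =
      subst (_< k) len (≤-trans (s≤s (≤-trans (⊆⇒length≤ u sub) (≤-reflexive (length-map pos (neighbours G v))))) (deg<k v))
      where
      sub : xs ⊆ map pos (neighbours G v)
      sub i∈ with u′ , v′ , eq , refl , e ← joined (proj₁ (spec i∈)) with refl ← pos-inj eq = ∈-map⁺ pos (∈-neighbours G e)

    no-F₄ : k ≤ 5 → ∀ {a t b} → a < t → t < b → a ~ b → a ~ t → t ~ b → Outer a b → Apex a t → Apex t b → ⊥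
    no-F₄ k≤5 a<t t<b ab at tb (w , out , aw , bw) (x , a<x , x<t , ax , xt) (y , t<y , y<b , ty , yb)
      with A , X , refl , refl , _ ← joined ax | T , Y , refl , refl , _ ← joined ty | B , W , refl , refl , _ ← joined bw =
        k≤5⇒no-F₄ k≤5 (lookup vs , lookup-injective distinct , edges)
      where
      -- In the numbering of `F4Edge`: the triangle first, then the vertices attached to `at`, `tb`
      -- and `ab`.
      vs : List (Fin n)
      vs = A ∷ T ∷ B ∷ X ∷ Y ∷ W ∷ []
      a<b = <-trans a<t t<b
      x<b = <-trans x<t t<b
      a<y = <-trans a<t t<y
      outside : ∀ {z} → pos A ≤ z → z ≤ pos B → z ≢ pos W
      outside a≤z z≤b refl = [ (λ w<a → <⇒≱ w<a a≤z) , (λ b<w → <⇒≱ b<w z≤b) ]′ out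
      ne : ∀ {u v} → pos u ≢ pos v → u ≢ v
      ne n refl = n refl
      distinct : Unique vs
      distinct =
        (ne (<⇒≢ a<t) ∷ ne (<⇒≢ a<b) ∷ ne (<⇒≢ a<x) ∷ ne (<⇒≢ a<y) ∷ ne (outside ≤-refl (<⇒≤ a<b)) ∷ []) ∷
        (ne (<⇒≢ t<b) ∷ ne (>⇒≢ x<t) ∷ ne (<⇒≢ t<y) ∷ ne (outside (<⇒≤ a<t) (<⇒≤ t<b)) ∷ []) ∷
        (ne (>⇒≢ x<b) ∷ ne (>⇒≢ y<b) ∷ ne (outside (<⇒≤ a<b) ≤-refl) ∷ []) ∷
        (ne (<⇒≢ (<-trans x<t t<y)) ∷ ne (outside (<⇒≤ a<x) (<⇒≤ x<b)) ∷ []) ∷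
        (ne (outside (<⇒≤ a<y) (<⇒≤ y<b)) ∷ []) ∷ [] ∷ []
      edges : ∀ x y → F4Edge x y → Edge G (lookup vs x) (lookup vs y)
      edges _ _ e01 = edge at
      edges _ _ e12 = edge tb
      edges _ _ e02 = edge ab
      edges _ _ e30 = edge-sym G (edge ax)
      edges _ _ e31 = edge xt
      edges _ _ e41 = edge-sym G (edge ty)
      edges _ _ e42 = edge yb
      edges _ _ e50 = edge-sym G (edge aw)
      edges _ _ e52 = edge-sym G (edge bw)

    square-colouring : Fin n → Σ (Fin n → Fin k) (IsProperColouring (square-adj G) k)
    square-colouring v₀ with N , pos<N ← strict-bound pos with ca , _ ← fresh [] (≤-trans (s≤s z≤n) (deg<k v₀)) =
      -- Positions are odd and below `N`, so 0 and `N` are isolated: the whole line is a leftward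
      -- piece with empty lists, and the colour of its ends is arbitrary.
      colour (solve N (m≤m+n N 0) (piece (≤-trans (s≤s z≤n) (pos<N v₀)) [] [] (λ ()) (λ ()) (λ e → ⊥-elim (zero-isolated e))
        (no-inner (≤-trans (s≤s z≤n) (pos<N v₀)) λ _ _ e → zero-isolated e)
        (no-inner (≤-trans (s≤s z≤n) (pos<N v₀)) λ _ _ e → N-isolated pos<N e)
        (leftward λ _ _ e → N-isolated pos<N e)))
      where
      open Colouring layout k (nbrs<k {v₀}) no-F₄
      zero-isolated : ∀ {i} → ¬ 0 ~ i
      zero-isolated e with _ , _ , () , _ ← joined e
      N-isolated : ∀ {N i} → (∀ v → pos v < N) → ¬ N ~ i
      N-isolated pos<N e with u , _ , eq , _ ← joined e = <⇒≢ (pos<N u) eq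
      colour : Sol 0 N ca ca [] [] → Σ (Fin n → Fin k) (IsProperColouring (square-adj G) k)
      colour s = (λ v → Sol.col s (pos v)) , λ u v e → proper (square⁻ G e)
        where
        ordered : ∀ {u v} → pos u < pos v → Near G u v → Sol.col s (pos u) ≢ Sol.col s (pos v)
        ordered {u} {v} lt (inj₁ e) = Sol.adj₁ s z≤n lt (<⇒≤ (pos<N v)) (adjacent e)
        ordered {u} {v} lt (inj₂ (w , e , e′)) = Sol.adj₂ s z≤n lt (<⇒≤ (pos<N v)) z≤n (<⇒≤ (pos<N w)) (adjacent (edge-sym G e)) (adjacent e′)
        near-sym : ∀ {u v} → Near G u v → Near G v u
        near-sym (inj₁ e) = inj₁ (edge-sym G e)
        near-sym (inj₂ (w , e , e′)) = inj₂ (w , edge-sym G e′ , edge-sym G e)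
        proper : ∀ {u v} → u ≢ v × Near G u v → Sol.col s (pos u) ≢ Sol.col s (pos v)
        proper {u} {v} (u≢v , near) eq with <-cmp (pos u) (pos v)
        ... | tri< lt _ _ = ordered lt near eq
        ... | tri≈ _ e _ = u≢v (pos-inj e)
        ... | tri> _ _ lt = ordered lt (near-sym near) (sym eq)

-- Clique and chromatic number of the square

theorem4p1 : ∀ (n : ℕ) (G : Graph (suc n)) → Chordal G → Outerplanar G →
    ((maxDegree G ≡ 4 × ContainsF4 G) →
    CliqueNumber (square-adj G) (maxDegree G + 2) ×
    ChromaticNumber (square-adj G) (maxDegree G + 2)) ×
    (¬ (maxDegree G ≡ 4 × ContainsF4 G) →
    CliqueNumber (square-adj G) (maxDegree G + 1) ×
    ChromaticNumber (square-adj G) (maxDegree G + 1))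
theorem4p1 n G chordal (p , p-inj , planar) = exceptional , generic
  where
  open Drawing G chordal p p-inj planar
  Δ : ℕ
  Δ = maxDegree G
  degree≤Δ : ∀ v → degree G v ≤ Δ
  degree≤Δ v = ≤-maximum (degree G) (∈-allFin v)
  Goal : ℕ → Set
  Goal k = CliqueNumber (square-adj G) k × ChromaticNumber (square-adj G) k
  exceptional : Δ ≡ 4 × ContainsF4 G → Goal (Δ + 2)
  exceptional (Δ≡4 , f , f-inj , edges) = subst Goal (cong (_+ 2) (sym Δ≡4))
    (clique+colouring (f , F₄.clique {G = G} f f-inj edges)
      -- With six colours the premise `k ≤ 5` is false, so the F₄ does no harm.
      (square-colouring 6 (λ v → s≤s (≤-trans (degree≤Δ v) (≤-trans (≤-reflexive Δ≡4) (n≤1+n 4))))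
        (λ { (s≤s (s≤s (s≤s (s≤s (s≤s ()))))) }) zero))
  generic : ¬ (Δ ≡ 4 × ContainsF4 G) → Goal (Δ + 1)
  generic ¬exc with v , deg≡Δ ← maximum-attained (degree G) zero (tabulate suc) =
    subst Goal (+-comm 1 Δ) (clique+colouring (subst (λ d → Σ (Fin (suc d) → Fin (suc n)) (IsClique (square-adj G) (suc d))) deg≡Δ (nbhd-clique G v))
      (square-colouring (suc Δ) (λ v → s≤s (degree≤Δ v)) no-F4 zero))
    where
    -- An F₄ forces `4 ≤ Δ`, so with at most five colours it would put `G` in the exceptional case.
    no-F4 : suc Δ ≤ 5 → ¬ ContainsF4 G
    no-F4 Δ<5 F@(f , f-inj , edges) =
      ¬exc (≤-antisym (≤-pred Δ<5) (≤-trans (F₄.degree≥4 {G = G} f f-inj edges) (degree≤Δ _)) , F)
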